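{- Let $\beta$ be a real number with $0<\beta$ sufficiently small compared with $1/(20\cdot 17^3)$, and let $n$ be a sufficiently large integer. Let $G$ be a graph on $n$ vertices with $\delta(G)\ge (n+1)/2$. If $G$ has a vertex-cut of size at most $5\beta n$, then $G$ contains a spanning Halin subgraph.
   Context: A homeomorphically irreducible tree (HIT) is a tree with no vertex of degree 2. A Halin graph is obtained from a HIT with at least 4 vertices embedded in the plane by connecting its leaves into a cycle following the cyclic order determined by the embedding. A spanning Halin subgraph of $G$ is a Halin subgraph of $G$ with vertex set $V(G)$. -}

module Defs where

open import Data.Nat using (ℕ; zero; suc; _+_; _*_; _≤_; _<_)
open import Data.Bool using (Bool; true; false; T)
open import Data.Fin using (Fin)
open import Data.Fin.Subset using (Subset; _∈_; _∉_)
open import Data.List using (List; []; _∷_; length; filter; allFin)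
open import Data.List.Relation.Unary.All using (All)
open import Data.List.Relation.Unary.Unique.Propositional using (Unique)
open import Data.Product using (Σ; ∃; _×_; _,_; proj₁; proj₂)
open import Data.Sum using (_⊎_)
open import Relation.Binary.PropositionalEquality using (_≡_; _≢_)
open import Relation.Nullary using (¬_)
open import Function using (_⇔_)
open import Data.Bool.Properties using (T?)

record Graph (n : ℕ) : Set where
  field
    adj   : Fin n → Fin n → Bool
    sym   : ∀ u v → adj u v ≡ adj v u
    irrefl : ∀ v → adj v v ≡ false
open Graph public

Adj : ∀ {n} → Graph n → Fin n → Fin n → Set
Adj G u v = T (adj G u v)

deg : ∀ {n} → Graph n → Fin n → ℕ
deg {n} G v = length (filter (λ u → T? (adj G v u)) (allFin n))

MinDegAtLeastHalf : ∀ {n} → Graph n → Set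
MinDegAtLeastHalf {n} G = ∀ v → n + 1 ≤ 2 * deg G v

data ReachIn {n} (G : Graph n) (P : Fin n → Set) : Fin n → Fin n → Set where
  here : ∀ {u} → P u → ReachIn G P u u
  step : ∀ {u w v} → P u → Adj G u w → ReachIn G P w v → ReachIn G P u v

IsVertexCut : ∀ {n} → Graph n → Subset n → Set
IsVertexCut G S = Σ _ λ u → Σ _ λ v → u ∉ S × v ∉ S × ¬ ReachIn G (λ x → x ∉ S) u v

Connected : ∀ {n} → Graph n → Set
Connected G = ∀ u v → ReachIn G (λ _ → ⊤') u v
  where
  open import Data.Unit using () renaming (⊤ to ⊤')

data Path {n} (G : Graph n) : List (Fin n) → Set where
  single : ∀ v → Path G (v ∷ [])
  cons   : ∀ {u v vs} → Adj G u v → Path G (v ∷ vs) → Path G (u ∷ v ∷ vs)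

last : ∀ {A : Set} → A → List A → A
last a [] = a
last a (b ∷ bs) = last b bs

HasCycle : ∀ {n} → Graph n → Set
HasCycle {n} G = Σ (Fin n) λ v → Σ (List (Fin n)) λ vs →
  3 ≤ length (v ∷ vs) × Unique (v ∷ vs) × Path G (v ∷ vs) × Adj G (last v vs) v

IsTree : ∀ {n} → Graph n → Set
IsTree G = Connected G × ¬ HasCycle G

IsHIT : ∀ {n} → Graph n → Set
IsHIT {n} G = IsTree G × (∀ v → deg G v ≢ 2)

Leaf : ∀ {n} → Graph n → Fin n → Set
Leaf G v = deg G v ≡ 1

iterate : ∀ {A : Set} → (A → A) → ℕ → A → A
iterate f zero a = a
iterate f (suc k) a = f (iterate f k a)

-- A combinatorial plane embedding (rotation system) of a graph: for each v, a
-- successor map ρ v on the neighbours of v which is a single cyclic permutation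
-- of N(v) (closure + every neighbour reachable from every other by iteration).
IsRotation : ∀ {n} → Graph n → (Fin n → Fin n → Fin n) → Set
IsRotation G ρ = ∀ v →
  (∀ u → Adj G v u → Adj G v (ρ v u)) ×
  (∀ u w → Adj G v u → Adj G v w → ∃ λ k → iterate (ρ v) k u ≡ w)

-- face-tracing step on darts (u , v): go to (v , ρ v u)
nextDart : ∀ {n} → (Fin n → Fin n → Fin n) → Fin n × Fin n → Fin n × Fin n
nextDart ρ (u , v) = (v , ρ v u)

-- In the plane tree (T, ρ), leaf ℓ' is the leaf following leaf ℓ along the
-- boundary walk: starting from the dart (ℓ , p) with p the neighbour of ℓ,
-- ℓ' is the head of the first dart whose head is a leaf.
LeafSucc : ∀ {n} → Graph n → (Fin n → Fin n → Fin n) → Fin n → Fin n → Set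
LeafSucc T ρ ℓ ℓ' = Leaf T ℓ × Σ _ λ p → Adj T ℓ p × Σ ℕ λ k →
  proj₂ (iterate (nextDart ρ) k (ℓ , p)) ≡ ℓ' × Leaf T ℓ' ×
  (∀ j → j < k → ¬ Leaf T (proj₂ (iterate (nextDart ρ) j (ℓ , p))))

-- H (on vertex set Fin n) is a Halin graph: H = T ∪ C where T is a HIT with
-- ≥ 4 vertices, embedded in the plane (rotation system ρ), and C is the cycle
-- through the leaves of T in the cyclic order determined by the embedding.
IsHalin : ∀ {n} → Graph n → Set
IsHalin {n} H = 4 ≤ n × Σ (Graph n) λ T → Σ (Fin n → Fin n → Fin n) λ ρ →
  IsHIT T × IsRotation T ρ ×
  (∀ u v → Adj H u v ⇔ (Adj T u v ⊎ LeafSucc T ρ u v ⊎ LeafSucc T ρ v u))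

Subgraph : ∀ {n} → Graph n → Graph n → Set
Subgraph H G = ∀ u v → Adj H u v → Adj G u v

HasSpanningHalinSubgraph : ∀ {n} → Graph n → Set
HasSpanningHalinSubgraph {n} G = Σ (Graph n) λ H → Subgraph H G × IsHalin H

{-# OPTIONS --safe #-}
-- Let S be a small cut separating x from y. The neighbourhoods of x and of y outside S are
-- disjoint, not joined by edges, and of size almost n/2, so the minimum degree makes each of them
-- an almost complete core; all but O(|S|) vertices lie in a core, and each of the others has about
-- n/4 neighbours in one of the cores. This splits V(G) into two sides, and since the smaller side
-- has at most n/2 vertices, each of its vertices has two neighbours across; a further degree count
-- gives three disjoint cross edges a₁b₁, a₂b₂, a₃b₃.
--
-- In a side with prescribed vertices r, a, z there is a plane spanning tree rooted at r in which
-- every inner vertex has at least two children and whose leaves, in order, form a path of G from a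
-- to z: a caterpillar of fans is built greedily through the exceptional vertices, and every
-- remaining core vertex v is then inserted as a leaf between two consecutive leaves of a fan. With
-- more fans than any core vertex has non-neighbours, one fan has its hub and both leaves adjacent
-- to v. Joining the trees of the two sides by a₁b₁, and the two leaf paths by a₂b₂ and a₃b₃, gives
-- the Halin subgraph.
module Submission where

open import Defs

module Lemmas where

  open import Data.Bool using (Bool; true; false; T; _∧_; _∨_; not; if_then_else_)
  open import Data.Bool.Properties using (T?; T-∧; T-∨; ∨-comm)
  open import Data.Empty using (⊥-elim)
  open import Data.Fin using (Fin; zero; suc)
  open import Data.Fin.Properties using (_≟_; suc-injective; any?)
  open import Data.Fin.Subset using (Subset; ∣_∣)
  import Data.Fin.Subset as Subset
  import Data.Integer as ℤ
  import Data.Integer.Properties as ℤ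
  open import Data.List using (List; []; _∷_; _++_; _∷ʳ_; map; length; filter; tabulate; allFin)
  open import Data.List.Membership.Propositional using (_∈_; _∉_)
  open import Data.List.Membership.Propositional.Properties
    using (∈-++⁺ˡ; ∈-++⁺ʳ; ∈-++⁻; ∈-filter⁺; ∈-filter⁻; ∈-allFin)
  open import Data.List.Properties using (map-++; ++-identityʳ; ++-assoc)
  open import Data.List.Relation.Binary.Permutation.Propositional using (_↭_; ↭-sym; ↭-trans; ↭⇒↭ₛ)
  open import Data.List.Relation.Binary.Permutation.Propositional.Properties
    using (shift; ++⁺ˡ; ∈-resp-↭; All-resp-↭)
  import Data.List.Relation.Binary.Permutation.Setoid.Properties as Permutation
  open import Data.List.Relation.Unary.All using (All; []; _∷_)
  import Data.List.Relation.Unary.All as All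
  open import Data.List.Relation.Unary.All.Properties using (++⁻ˡ; ++⁻ʳ; ¬Any⇒All¬; All¬⇒¬Any)
  open import Data.List.Relation.Unary.AllPairs using ([]; _∷_)
  import Data.List.Relation.Unary.AllPairs as AllPairs
  open import Data.List.Relation.Unary.Any using (here; there)
  open import Data.List.Relation.Unary.Unique.Propositional using (Unique)
  open import Data.List.Relation.Unary.Unique.Propositional.Properties using (allFin⁺; filter⁺; ++⁺)
  open import Data.Nat using (ℕ; zero; suc; z≤n; s≤s; _+_; _*_; _≤_; _<_; _≤?_)
  open import Data.Nat.Properties hiding (_≟_; suc-injective)
  open import Data.Nat.Tactic.RingSolver using (solve-∀)
  open import Data.Product using (Σ; ∃; ∃₂; _×_; _,_; proj₁; proj₂)
  open import Data.Product.Properties using (≡-dec)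
  import Data.Rational as ℚ
  import Data.Rational.Properties as ℚ
  import Data.Rational.Unnormalised as ℚᵘ
  import Data.Rational.Unnormalised.Properties as ℚᵘ
  open import Data.Sum using (_⊎_; inj₁; inj₂; [_,_]′; swap)
  open import Data.Unit using (⊤; tt)
  open import Data.Vec using ([]; _∷_; lookup)
  open import Data.Vec.Properties using ([]=⇒lookup)
  open import Function using (_∘_; _|>′_; Equivalence; mk⇔)
  open import Relation.Binary.Definitions using (tri<; tri≈; tri>)
  open import Relation.Binary.PropositionalEquality
    using (_≡_; _≢_; refl; trans; cong; cong₂; subst; subst₂; ≢-sym; setoid) renaming (sym to ≡-sym)
  open import Relation.Nullary using (¬_; Dec; yes; no; contradiction; ¬?; _×-dec_)
  open import Relation.Nullary.Decidable using (⌊_⌋; toWitness; fromWitness)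
  open Equivalence using (to; from)

  -- Counting vertices

  indicator : Bool → ℕ
  indicator b = if b then 1 else 0

  # : ∀ {n} → (Fin n → Bool) → ℕ
  # {zero}  P = 0
  # {suc n} P = indicator (P zero) + # (P ∘ suc)

  length-filter-tabulate : ∀ {m n} (P : Fin m → Bool) (f : Fin n → Fin m) →
    length (filter (λ v → T? (P v)) (tabulate f)) ≡ # (P ∘ f)
  length-filter-tabulate {n = zero}  P f = refl
  length-filter-tabulate {n = suc n} P f with P (f zero)
  ... | true  = cong suc (length-filter-tabulate P (f ∘ suc))
  ... | false = length-filter-tabulate P (f ∘ suc)

  deg≡# : ∀ {n} (G : Graph n) v → deg G v ≡ # (adj G v)
  deg≡# G v = length-filter-tabulate (adj G v) (λ u → u)

  indicator-mono : ∀ a b → (T a → T b) → indicator a ≤ indicator b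
  indicator-mono false b     h = z≤n
  indicator-mono true  true  h = ≤-refl
  indicator-mono true  false h = ⊥-elim (h tt)

  #-mono : ∀ {n} (P Q : Fin n → Bool) → (∀ v → T (P v) → T (Q v)) → # P ≤ # Q
  #-mono {zero}  P Q h = z≤n
  #-mono {suc n} P Q h =
    +-mono-≤ (indicator-mono (P zero) (Q zero) (h zero)) (#-mono (P ∘ suc) (Q ∘ suc) (h ∘ suc))

  +-interchange : ∀ a b c d → (a + b) + (c + d) ≡ (a + c) + (b + d)
  +-interchange = solve-∀

  #-split : ∀ {n} (P Q : Fin n → Bool) →
    # P ≡ # (λ v → P v ∧ Q v) + # (λ v → P v ∧ not (Q v))
  #-split {zero}  P Q = refl
  #-split {suc n} P Q = trans (cong₂ _+_ (split₁ (P zero) (Q zero)) (#-split (P ∘ suc) (Q ∘ suc)))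
    (+-interchange (indicator (P zero ∧ Q zero)) (indicator (P zero ∧ not (Q zero)))
       (# (λ v → P (suc v) ∧ Q (suc v))) _)
    where
    split₁ : ∀ p q → indicator p ≡ indicator (p ∧ q) + indicator (p ∧ not q)
    split₁ false q     = refl
    split₁ true  true  = refl
    split₁ true  false = refl

  #-full : ∀ n → # {n} (λ _ → true) ≡ n
  #-full zero    = refl
  #-full (suc n) = cong suc (#-full n)

  #-empty : ∀ {n} (P : Fin n → Bool) → (∀ v → ¬ T (P v)) → # P ≡ 0
  #-empty {zero}  P h = refl
  #-empty {suc n} P h with P zero in eq
  ... | true  = ⊥-elim (h zero (subst T (≡-sym eq) tt))
  ... | false = #-empty (P ∘ suc) (h ∘ suc)

  #-singleton : ∀ {n} (v : Fin n) → # (λ x → ⌊ x ≟ v ⌋) ≡ 1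
  #-singleton {suc n} zero = cong suc (#-empty {n} (λ x → ⌊ suc x ≟ zero ⌋) (λ v ()))
  #-singleton {suc n} (suc v) = trans
    (≤-antisym (#-mono (λ x → ⌊ suc x ≟ suc v ⌋) (λ x → ⌊ x ≟ v ⌋)
                  (λ x h → fromWitness (suc-injective (toWitness h))))
               (#-mono (λ x → ⌊ x ≟ v ⌋) (λ x → ⌊ suc x ≟ suc v ⌋)
                  (λ x h → fromWitness (cong suc (toWitness h)))))
    (#-singleton v)

  T-not : ∀ {b} → ¬ T b → T (not b)
  T-not {true}  h = h tt
  T-not {false} h = tt

  T-not⁻ : ∀ {b} → T (not b) → ¬ T b
  T-not⁻ {false} _ ()

  infixl 6 _∖_
  _∖_ : ∀ {n} → (Fin n → Bool) → Fin n → (Fin n → Bool)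
  (P ∖ v) x = P x ∧ not ⌊ x ≟ v ⌋

  ∈-∖⁺ : ∀ {n} {P : Fin n → Bool} {v x} → T (P x) → x ≢ v → T ((P ∖ v) x)
  ∈-∖⁺ p x≢v = from T-∧ (p , T-not (λ t → x≢v (toWitness t)))

  ∈-∖⁻ : ∀ {n} {P : Fin n → Bool} {v x} → T ((P ∖ v) x) → T (P x) × x ≢ v
  ∈-∖⁻ t with to T-∧ t
  ... | p , q = p , λ e → T-not⁻ q (fromWitness e)

  #-remove-≤ : ∀ {n} (P : Fin n → Bool) v → # P ≤ suc (# (P ∖ v))
  #-remove-≤ P v = begin
    # P                                   ≡⟨ #-split P (λ x → ⌊ x ≟ v ⌋) ⟩
    # (λ x → P x ∧ ⌊ x ≟ v ⌋) + # (P ∖ v) ≤⟨ +-monoˡ-≤ _ (#-mono _ _ (λ x t → proj₂ (to (T-∧ {P x}) t))) ⟩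
    # (λ x → ⌊ x ≟ v ⌋) + # (P ∖ v)       ≡⟨ cong (_+ # (P ∖ v)) (#-singleton v) ⟩
    suc (# (P ∖ v))                       ∎
    where open ≤-Reasoning

  #-remove-≥ : ∀ {n} (P : Fin n → Bool) v → T (P v) → suc (# (P ∖ v)) ≤ # P
  #-remove-≥ P v Pv = begin
    suc (# (P ∖ v))                       ≡⟨ cong (_+ # (P ∖ v)) (≡-sym (#-singleton v)) ⟩
    # (λ x → ⌊ x ≟ v ⌋) + # (P ∖ v)
      ≤⟨ +-monoˡ-≤ _ (#-mono (λ x → ⌊ x ≟ v ⌋) (λ x → P x ∧ ⌊ x ≟ v ⌋)
           (λ x t → from T-∧ (subst (T ∘ P) (≡-sym (toWitness t)) Pv , t))) ⟩
    # (λ x → P x ∧ ⌊ x ≟ v ⌋) + # (P ∖ v) ≡⟨ ≡-sym (#-split P (λ x → ⌊ x ≟ v ⌋)) ⟩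
    # P                                   ∎
    where open ≤-Reasoning

  unique-length≤# : ∀ {n} (P : Fin n → Bool) {xs} → Unique xs → All (T ∘ P) xs → length xs ≤ # P
  unique-length≤# P [] [] = z≤n
  unique-length≤# P {x ∷ xs} (x∉ ∷ u) (px ∷ pxs) = ≤-trans
    (s≤s (unique-length≤# (P ∖ x) u (All.zipWith (λ (p , x≢y) → ∈-∖⁺ {P = P} p (≢-sym x≢y)) (pxs , x∉))))
    (#-remove-≥ P x px)

  #≤length : ∀ {n} (P : Fin n → Bool) xs → (∀ v → T (P v) → v ∈ xs) → # P ≤ length xs
  #≤length P []       h = ≤-reflexive (#-empty P (λ v p → contradiction (h v p) λ ()))
  #≤length P (x ∷ xs) h = ≤-trans (#-remove-≤ P x) (s≤s (#≤length (P ∖ x) xs h′))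
    where
    h′ : ∀ v → T ((P ∖ x) v) → v ∈ xs
    h′ v t with ∈-∖⁻ {P = P} t
    ... | p , v≢x with h v p
    ...   | here v≡x = contradiction v≡x v≢x
    ...   | there v∈ = v∈

  #>0⇒∃ : ∀ {n} (P : Fin n → Bool) → 0 < # P → ∃ λ v → T (P v)
  #>0⇒∃ {suc n} P h with P zero in eq
  ... | true  = zero , subst T (≡-sym eq) tt
  ... | false with #>0⇒∃ (P ∘ suc) h
  ...   | v , p = suc v , p

  pick : ∀ {n} (P : Fin n → Bool) xs → length xs < # P → ∃ λ v → T (P v) × v ∉ xs
  pick P []       h with #>0⇒∃ P h
  ... | v , p = v , p , λ ()
  pick P (x ∷ xs) h with pick (P ∖ x) xs (≤-pred (≤-trans h (#-remove-≤ P x)))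
  ... | v , t , v∉ with ∈-∖⁻ {P = P} t
  ...   | p , v≢x = v , p , λ { (here e) → v≢x e ; (there i) → v∉ i }

  -- Walks and cyclic successors

  -- The list omits the start and contains the end, so walks concatenate by `_++_` and a closed walk
  -- from `x` has a list of the form `xs ∷ʳ x`.
  data Walk {A : Set} (R : A → A → Set) : A → List A → A → Set where
    []  : ∀ {a} → Walk R a [] a
    _∷_ : ∀ {a b xs z} → R a b → Walk R b xs z → Walk R a (b ∷ xs) z

  pairs : ∀ {A : Set} → A → List A → A → List (A × A)
  pairs a []       z = (a , z) ∷ []
  pairs a (b ∷ bs) z = (a , b) ∷ pairs b bs z

  module _ {A : Set} {R : A → A → Set} where

    infixr 5 _++ʷ_
    _++ʷ_ : ∀ {a b c xs ys} → Walk R a xs b → Walk R b ys c → Walk R a (xs ++ ys) c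
    []      ++ʷ w′ = w′
    (r ∷ w) ++ʷ w′ = r ∷ (w ++ʷ w′)

    unsnoc : ∀ {a z} xs {y} → Walk R a (xs ∷ʳ y) z → y ≡ z × ∃ λ m → Walk R a xs m × R m y
    unsnoc []       (r ∷ []) = refl , _ , [] , r
    unsnoc (x ∷ xs) (r ∷ w) with unsnoc xs w
    ... | e , m , w′ , r′ = e , m , r ∷ w′ , r′

    walk-map : ∀ {S : A → A → Set} {a z} xs {y} → (∀ {b c} → b ∈ a ∷ xs → R b c → S b c) →
      Walk R a (xs ∷ʳ y) z → Walk S a (xs ∷ʳ y) z
    walk-map []       f (r ∷ []) = f (here refl) r ∷ []
    walk-map (x ∷ xs) f (r ∷ w)  = f (here refl) r ∷ walk-map xs (f ∘ there) w

    pairs-walk : ∀ {a z} xs {y} → Walk R a (xs ∷ʳ y) z → All (λ (b , c) → R b c) (pairs a xs y)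
    pairs-walk []       (r ∷ []) = r ∷ []
    pairs-walk (x ∷ xs) (r ∷ w)  = r ∷ pairs-walk xs w

  pairs-source : ∀ {A : Set} {a b : A} xs {y} → b ∈ a ∷ xs → ∃ λ c → (b , c) ∈ pairs a xs y
  pairs-source []       (here refl) = _ , here refl
  pairs-source (x ∷ xs) (here refl) = _ , here refl
  pairs-source (x ∷ xs) (there i) with pairs-source xs i
  ... | c , j = c , there j

  iterate-shift : ∀ {A : Set} (f : A → A) k a → iterate f k (f a) ≡ iterate f (suc k) a
  iterate-shift f zero    a = refl
  iterate-shift f (suc k) a = cong f (iterate-shift f k a)

  iterate-+ : ∀ {A : Set} (f : A → A) k l a → iterate f k (iterate f l a) ≡ iterate f (k + l) a
  iterate-+ f zero    l a = refl
  iterate-+ f (suc k) l a = cong f (iterate-+ f k l a)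

  -- Meant for closed walks: running from one entry to the common endpoint and from there to another
  -- entry makes `cyclicSuc` transitive.
  walk-iterate : ∀ {A : Set} {f : A → A} {x xs z a} → Walk (λ b c → f b ≡ c) x xs z → a ∈ x ∷ xs →
    (∃ λ k → iterate f k x ≡ a) × (∃ λ k → iterate f k a ≡ z)
  walk-iterate []      (here refl) = (0 , refl) , (0 , refl)
  walk-iterate {f = f} {x} (refl ∷ w) (here refl) with walk-iterate w (here refl)
  ... | _ , k , e = (0 , refl) , (suc k , trans (≡-sym (iterate-shift f k x)) e)
  walk-iterate {f = f} {x} (refl ∷ w) (there i) with walk-iterate w i
  ... | (k , e) , q = (suc k , trans (≡-sym (iterate-shift f k x)) e) , q

  maximum : ∀ {A : Set} (f : A → ℕ) x xs → ∃ λ m → m ∈ x ∷ xs × (∀ {y} → y ∈ x ∷ xs → f y ≤ f m)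
  maximum f x [] = x , here refl , λ { (here refl) → ≤-refl }
  maximum f x (y ∷ ys) with maximum f y ys
  ... | m , m∈ , max with ≤-total (f x) (f m)
  ...   | inj₁ x≤m = m , there m∈ , λ { (here refl) → x≤m ; (there i) → max i }
  ...   | inj₂ m≤x = x , here refl , λ { (here refl) → ≤-refl ; (there i) → ≤-trans (max i) m≤x }

  last-∈ : ∀ {A : Set} (x : A) xs → last x xs ∈ x ∷ xs
  last-∈ x []       = here refl
  last-∈ x (y ∷ ys) = there (last-∈ y ys)

  -- `h` follows the last entry, so passing the head of the list closes it into a cycle. It is also
  -- the value at arguments outside the list, which keeps every value in `h ∷ ys`.
  nextIn : ∀ {n} → Fin n → Fin n → List (Fin n) → Fin n → Fin n
  nextIn h x []       u = h
  nextIn h x (y ∷ ys) u with u ≟ x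
  ... | yes _ = y
  ... | no  _ = nextIn h y ys u

  cyclicSuc : ∀ {n} → List (Fin n) → Fin n → Fin n
  cyclicSuc []       u = u
  cyclicSuc (x ∷ xs) u = nextIn x x xs u

  nextIn-walk : ∀ {n} {x : Fin n} {ys} h → Unique (x ∷ ys) →
    Walk (λ a b → nextIn h x ys a ≡ b) x (ys ∷ʳ h) h
  nextIn-walk {ys = []} h u = refl ∷ []
  nextIn-walk {x = x} {ys = y ∷ ys} h (x∉ ∷ u) = first ∷ walk-map ys later (nextIn-walk h u)
    where
    first : nextIn h x (y ∷ ys) x ≡ y
    first with x ≟ x
    ... | yes _ = refl
    ... | no ne = contradiction refl ne
    later : ∀ {b c} → b ∈ y ∷ ys → nextIn h y ys b ≡ c → nextIn h x (y ∷ ys) b ≡ c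
    later {b} b∈ e with b ≟ x
    ... | yes refl = contradiction b∈ (All¬⇒¬Any x∉)
    ... | no _ = e

  cyclicSuc-walk : ∀ {n} {x : Fin n} {xs} → Unique (x ∷ xs) →
    Walk (λ a b → cyclicSuc (x ∷ xs) a ≡ b) x (xs ∷ʳ x) x
  cyclicSuc-walk u = nextIn-walk _ u

  nextIn-∈ : ∀ {n} (h x : Fin n) ys u → nextIn h x ys u ∈ h ∷ ys
  nextIn-∈ h x []       u = here refl
  nextIn-∈ h x (y ∷ ys) u with u ≟ x
  ... | yes _ = there (here refl)
  ... | no  _ with nextIn-∈ h y ys u
  ...   | here e  = here e
  ...   | there i = there (there i)

  cyclicSuc-∈ : ∀ {n} (xs : List (Fin n)) {u} → u ∈ xs → cyclicSuc xs u ∈ xs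
  cyclicSuc-∈ (x ∷ xs) {u} _ = nextIn-∈ x x xs u

  cyclicSuc-transitive : ∀ {n} (xs : List (Fin n)) {u w} → Unique xs → u ∈ xs → w ∈ xs →
    ∃ λ k → iterate (cyclicSuc xs) k u ≡ w
  cyclicSuc-transitive (x ∷ xs) {u} {w} uniq u∈ w∈
    with walk-iterate (cyclicSuc-walk uniq) (∈-++⁺ˡ {ys = x ∷ []} u∈)
       | walk-iterate (cyclicSuc-walk uniq) (∈-++⁺ˡ {ys = x ∷ []} w∈)
  ... | _ , k , e | (l , e′) , _ =
    l + k , trans (≡-sym (iterate-+ _ l k u)) (trans (cong (iterate _ l) e) e′)

  -- Plane trees and Halin graphs

  -- Ordered forests in first-child / next-sibling form.
  data Forest (n : ℕ) : Set where
    nil  : Forest n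
    cons : Fin n → (children siblings : Forest n) → Forest n

  -- A vertex is recorded with its depth and its neighbours in cyclic order, parent first.
  Info : ℕ → Set
  Info n = ℕ × List (Fin n)

  module _ {n : ℕ} where

    roots labels leaves : Forest n → List (Fin n)

    roots nil            = []
    roots (cons v cs ss) = v ∷ roots ss

    labels nil            = []
    labels (cons v cs ss) = v ∷ labels cs ++ labels ss

    leaves nil                       = []
    leaves (cons v nil ss)           = v ∷ leaves ss
    leaves (cons v cs@(cons _ _ _) ss) = leaves cs ++ leaves ss

    -- Below a root, the neighbours of a vertex are its parent and its children, so degree 2 means
    -- exactly one child.
    Branching : Forest n → Set
    Branching nil            = ⊤
    Branching (cons v cs ss) = length (roots cs) ≢ 1 × Branching cs × Branching ss

    EdgesIn : Graph n → Fin n → Forest n → Set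
    EdgesIn G q nil            = ⊤
    EdgesIn G q (cons v cs ss) = Adj G q v × EdgesIn G v cs × EdgesIn G q ss

    roots⊆labels : ∀ F {v} → v ∈ roots F → v ∈ labels F
    roots⊆labels (cons v cs ss) (here e)  = here e
    roots⊆labels (cons v cs ss) (there i) = there (∈-++⁺ʳ (labels cs) (roots⊆labels ss i))

    unique-++ˡ : ∀ xs {ys : List (Fin n)} → Unique (xs ++ ys) → Unique xs
    unique-++ˡ []       u       = []
    unique-++ˡ (x ∷ xs) (p ∷ u) = ++⁻ˡ xs p ∷ unique-++ˡ xs u

    unique-++ʳ : ∀ xs {ys : List (Fin n)} → Unique (xs ++ ys) → Unique ys
    unique-++ʳ []       u       = u
    unique-++ʳ (x ∷ xs) (p ∷ u) = unique-++ʳ xs u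

    unique-roots : ∀ F → Unique (labels F) → Unique (roots F)
    unique-roots nil            u       = []
    unique-roots (cons v cs ss) (p ∷ u) =
      All.tabulate (λ i → All.lookup (++⁻ʳ (labels cs) p) (roots⊆labels ss i)) ∷
      unique-roots ss (unique-++ʳ (labels cs) u)

    entries : Fin n → ℕ → Forest n → List (Fin n × Info n)
    entries q d nil            = []
    entries q d (cons v cs ss) = (v , d , q ∷ roots cs) ∷ entries v (suc d) cs ++ entries q d ss

    entries-keys : ∀ q d F → map proj₁ (entries q d F) ≡ labels F
    entries-keys q d nil            = refl
    entries-keys q d (cons v cs ss) = cong (v ∷_) (trans (map-++ proj₁ (entries v (suc d) cs) _)
      (cong₂ _++_ (entries-keys v (suc d) cs) (entries-keys q d ss)))

    lookupInfo : List (Fin n × Info n) → Fin n → Info n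
    -- This default is never read in `PlaneTree`, where `covers` makes every vertex a key.
    lookupInfo []             x = 0 , []
    lookupInfo ((k , a) ∷ es) x with x ≟ k
    ... | yes _ = a
    ... | no  _ = lookupInfo es x

    lookupInfo-∈ : ∀ es {k a} → Unique (map proj₁ es) → (k , a) ∈ es → lookupInfo es k ≡ a
    lookupInfo-∈ ((k , a) ∷ es) u (here refl) with k ≟ k
    ... | yes _ = refl
    ... | no ne = contradiction refl ne
    lookupInfo-∈ ((k′ , _) ∷ es) {k} (p ∷ u) (there i) with k ≟ k′
    ... | yes refl = contradiction (key-∈ i) (All¬⇒¬Any p)
      where
      key-∈ : ∀ {es k a} → (k , a) ∈ es → k ∈ map proj₁ es
      key-∈ (here refl) = here refl
      key-∈ (there j)   = there (key-∈ j)
    ... | no _ = lookupInfo-∈ es u i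

  module _ {n : ℕ} {G : Graph n} where

    reach-++ : ∀ {P u v w} → ReachIn G P u v → ReachIn G P v w → ReachIn G P u w
    reach-++ (here p)     s = s
    reach-++ (step p a s) t = step p a (reach-++ s t)

    adj-sym : ∀ {u v} → Adj G u v → Adj G v u
    adj-sym {u} {v} = subst T (sym G u v)

    -- The predecessor of `x` on the path and its successor, where `c` follows the last vertex; they
    -- differ because no vertex repeats.
    inner-neighbours : ∀ {u vs c} → Path G (u ∷ vs) → Unique (u ∷ vs) → c ∉ u ∷ vs →
      Adj G (last u vs) c → ∀ {x} → x ∈ vs →
      ∃₂ λ y z → y ≢ z × y ∈ u ∷ vs × z ∈ c ∷ vs × Adj G x y × Adj G x z
    inner-neighbours (cons a (single v)) _ c∉ close (here refl) =
      _ , _ , (λ { refl → c∉ (here refl) }) , here refl , here refl , adj-sym a , close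
    inner-neighbours (cons a (cons b p)) ((_ ∷ u≢ ∷ _) ∷ _) c∉ close (here refl) =
      _ , _ , u≢ , here refl , there (there (here refl)) , adj-sym a , b
    inner-neighbours {vs = v ∷ vs} (cons a p) (_ ∷ u) c∉ close (there i)
      with inner-neighbours p u (c∉ ∘ there) close i
    ... | y , z , ne , y∈ , here e   , a₁ , a₂ = y , z , ne , there y∈ , here e , a₁ , a₂
    ... | y , z , ne , y∈ , there z∈ , a₁ , a₂ = y , z , ne , there y∈ , there (there z∈) , a₁ , a₂

    cycle-neighbours : ∀ {v vs} → 3 ≤ length (v ∷ vs) → Unique (v ∷ vs) → Path G (v ∷ vs) →
      Adj G (last v vs) v → ∀ {x} → x ∈ v ∷ vs →
      ∃₂ λ y z → y ≢ z × y ∈ v ∷ vs × z ∈ v ∷ vs × Adj G x y × Adj G x z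
    cycle-neighbours {v} {a ∷ b ∷ vs} _ (_ ∷ (a∉ ∷ _)) (cons e p) close (here refl) =
      a , last b vs , All.lookup a∉ (last-∈ b vs) , there (here refl) , there (there (last-∈ b vs)) ,
      e , adj-sym close
    cycle-neighbours {v} {a ∷ b ∷ vs} _ ((_ ∷ v≢b ∷ _) ∷ _) (cons e (cons f p)) close (there (here refl)) =
      v , b , v≢b , here refl , there (there (here refl)) , adj-sym e , f
    cycle-neighbours {v} {a ∷ b ∷ vs} _ (v∉ ∷ u) (cons e p) close (there (there i))
      with inner-neighbours p u (All¬⇒¬Any v∉) close i
    ... | y , z , ne , y∈ , here e′  , a₁ , a₂ = y , z , ne , there y∈ , here e′ , a₁ , a₂
    ... | y , z , ne , y∈ , there z∈ , a₁ , a₂ = y , z , ne , there y∈ , there (there z∈) , a₁ , a₂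
    cycle-neighbours {vs = []}     (s≤s ())
    cycle-neighbours {vs = _ ∷ []} (s≤s (s≤s ()))

  T⇔⇒≡ : ∀ {a b} → (T a → T b) → (T b → T a) → a ≡ b
  T⇔⇒≡ {false} {false} f g = refl
  T⇔⇒≡ {false} {true}  f g = ⊥-elim (g tt)
  T⇔⇒≡ {true}  {false} f g = ⊥-elim (f tt)
  T⇔⇒≡ {true}  {true}  f g = refl

  ¬T⇒≡false : ∀ {b} → ¬ T b → b ≡ false
  ¬T⇒≡false {false} h = refl
  ¬T⇒≡false {true}  h = ⊥-elim (h tt)

  -- The root has no parent, so it needs three children of its own to be neither a leaf nor of
  -- degree 2.
  module PlaneTree {n : ℕ} (r : Fin n) (F : Forest n) (unique : Unique (r ∷ labels F))
    (covers : ∀ v → v ∈ r ∷ labels F) (3≤roots : 3 ≤ length (roots F)) (branching : Branching F) where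

    open import Data.List.Membership.DecPropositional (_≟_ {n}) using (_∈?_)

    -- The tree given by neighbour lists

    allEntries : List (Fin n × Info n)
    allEntries = (r , 0 , roots F) ∷ entries r 1 F

    -- Opaque, so that the arguments of rank and nb can be inferred.
    abstract
      info : Fin n → Info n
      info = lookupInfo allEntries

      agrees-all : All (λ (k , a) → info k ≡ a) allEntries
      agrees-all = All.tabulate λ i →
        lookupInfo-∈ allEntries (subst Unique (cong (r ∷_) (≡-sym (entries-keys r 1 F))) unique) i

    rank : Fin n → ℕ
    rank v = proj₁ (info v)

    nb : Fin n → List (Fin n)
    nb v = proj₂ (info v)

    Agrees : Fin n → ℕ → Forest n → Set
    Agrees q d E = All (λ (k , a) → info k ≡ a) (entries q d E)

    info-root : info r ≡ (0 , roots F)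
    info-root = All.head agrees-all

    agrees : Agrees r 1 F
    agrees = All.tail agrees-all

    info-roots : ∀ q d E → Agrees q d E → ∀ {w} → w ∈ roots E → ∃ λ ks → info w ≡ (d , q ∷ ks)
    info-roots q d (cons v cs ss) (e ∷ es) (here refl) = _ , e
    info-roots q d (cons v cs ss) (e ∷ es) (there i)   = info-roots q d ss (++⁻ʳ (entries v (suc d) cs) es) i

    -- A neighbour is either the parent, of smaller rank, or a child, of larger rank. Symmetry,
    -- irreflexivity and acyclicity of `tree` rest on this.
    record Child (u : Fin n) : Set where
      constructor child
      field
        parent    : Fin n
        kids      : List (Fin n)
        nb≡       : nb u ≡ parent ∷ kids
        parent-up : rank parent < rank u × u ∈ nb parent
        kids-down : ∀ {v} → v ∈ kids → rank u < rank v × u ∈ nb v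

    children-down : ∀ q d E → Agrees q (suc d) E → rank q ≡ d → ∀ {v} → v ∈ roots E → rank q < rank v × q ∈ nb v
    children-down q d E ag refl {v} i with info-roots q (suc d) E ag i
    ... | ks , e = subst (d <_) (≡-sym (cong proj₁ e)) ≤-refl , subst (q ∈_) (≡-sym (cong proj₂ e)) (here refl)

    isChild : ∀ q d E → Agrees q (suc d) E → rank q ≡ d → (∀ {v} → v ∈ roots E → v ∈ nb q) →
      ∀ {u} → u ∈ labels E → Child u
    isChild q d (cons v cs ss) (e ∷ es) eq up (here refl) =
      child q (roots cs) (cong proj₂ e)
        (subst (_ <_) (≡-sym (cong proj₁ e)) (≤-reflexive (cong suc eq)) , up (here refl))
        (children-down v (suc d) cs (++⁻ˡ _ es) (cong proj₁ e))
    isChild q d (cons v cs ss) (e ∷ es) eq up (there i) with ∈-++⁻ (labels cs) i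
    ... | inj₁ j = isChild v (suc d) cs (++⁻ˡ _ es) (cong proj₁ e)
                     (λ k → subst (_ ∈_) (≡-sym (cong proj₂ e)) (there k)) j
    ... | inj₂ j = isChild q d ss (++⁻ʳ (entries v (suc (suc d)) cs) es) eq (up ∘ there) j

    root-or-child : ∀ v → v ≡ r ⊎ (v ∈ labels F × Child v)
    root-or-child v with covers v
    ... | here e  = inj₁ e
    ... | there i = inj₂ (i , isChild r 0 F agrees (cong proj₁ info-root)
                                (subst (_ ∈_) (≡-sym (cong proj₂ info-root))) i)

    root-down : ∀ {v} → v ∈ nb r → rank r < rank v × r ∈ nb v
    root-down i = children-down r 0 F agrees (cong proj₁ info-root) (subst (_ ∈_) (cong proj₂ info-root) i)

    nb-sym : ∀ {u v} → v ∈ nb u → u ∈ nb v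
    nb-sym {u} {v} i with root-or-child u
    ... | inj₁ refl = proj₂ (root-down i)
    ... | inj₂ (_ , child p ks e up down) with subst (v ∈_) e i
    ...   | here refl = proj₂ up
    ...   | there j   = proj₂ (down j)

    nb-irrefl : ∀ {v} → v ∉ nb v
    nb-irrefl {v} i with root-or-child v
    ... | inj₁ refl = <-irrefl refl (proj₁ (root-down i))
    ... | inj₂ (_ , child p ks e up down) with subst (v ∈_) e i
    ...   | here refl = <-irrefl refl (proj₁ up)
    ...   | there j   = <-irrefl refl (proj₁ (down j))

    -- Children lie strictly deeper, so a neighbour of `u` that is not deeper than `u` can only be
    -- the parent.
    lower-unique : ∀ {u v w} → v ∈ nb u → w ∈ nb u → rank v ≤ rank u → rank w ≤ rank u → v ≡ w
    lower-unique {u} {v} {w} i j v≤u w≤u with root-or-child u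
    ... | inj₁ refl = contradiction v≤u (<⇒≱ (proj₁ (root-down i)))
    ... | inj₂ (_ , child p ks e up down) with subst (v ∈_) e i | subst (w ∈_) e j
    ...   | here refl | here refl = refl
    ...   | here _    | there j′  = contradiction w≤u (<⇒≱ (proj₁ (down j′)))
    ...   | there i′  | _         = contradiction v≤u (<⇒≱ (proj₁ (down i′)))

    tree : Graph n
    tree = record
      { adj    = λ u v → ⌊ v ∈? nb u ⌋
      ; sym    = λ u v → T⇔⇒≡ (λ t → fromWitness (nb-sym (toWitness t))) (λ t → fromWitness (nb-sym (toWitness t)))
      ; irrefl = λ v → ¬T⇒≡false (λ t → nb-irrefl (toWitness t))
      }

    adj⇒∈ : ∀ {u v} → Adj tree u v → v ∈ nb u
    adj⇒∈ = toWitness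

    ∈⇒adj : ∀ {u v} → v ∈ nb u → Adj tree u v
    ∈⇒adj = fromWitness

    -- The bound `k` on the rank makes the climb from parent to parent terminate.
    reach-root : ∀ k u → rank u < k → ReachIn tree (λ _ → ⊤) u r × ReachIn tree (λ _ → ⊤) r u
    reach-root (suc k) u (s≤s u≤k) with root-or-child u
    ... | inj₁ refl = here tt , here tt
    ... | inj₂ (_ , child p ks e (p<u , u∈) _) with reach-root k p (≤-trans p<u u≤k)
    ...   | up , down = step tt (∈⇒adj (nb-sym u∈)) up , reach-++ down (step tt (∈⇒adj u∈) (here tt))

    connected : Connected tree
    connected u v = reach-++ (proj₁ (reach-root _ u ≤-refl)) (proj₂ (reach-root _ v ≤-refl))

    -- A deepest vertex of a cycle would have two distinct neighbours that are not deeper, against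
    -- `lower-unique`.
    acyclic : ¬ HasCycle tree
    acyclic (v , vs , 3≤ , uniq , path , close) with maximum rank v vs
    ... | m , m∈ , max with cycle-neighbours 3≤ uniq path close m∈
    ...   | y , z , y≢z , y∈ , z∈ , a , b = y≢z (lower-unique (adj⇒∈ a) (adj⇒∈ b) (max y∈) (max z∈))

    unique-children : ∀ q d E → Agrees q d E → Unique (q ∷ labels E) → ∀ {u} → u ∈ labels E → Unique (nb u)
    unique-children q d (cons v cs ss) (e ∷ es) ((_ ∷ q∉) ∷ (_ ∷ u)) (here refl) =
      subst Unique (≡-sym (cong proj₂ e))
        (All.tabulate (λ i → All.lookup (++⁻ˡ (labels cs) q∉) (roots⊆labels cs i)) ∷
         unique-roots cs (unique-++ˡ (labels cs) u))
    unique-children q d (cons v cs ss) (e ∷ es) ((_ ∷ q∉) ∷ (v∉ ∷ u)) (there i) with ∈-++⁻ (labels cs) i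
    ... | inj₁ j = unique-children v (suc d) cs (++⁻ˡ _ es) (++⁻ˡ (labels cs) v∉ ∷ unique-++ˡ (labels cs) u) j
    ... | inj₂ j = unique-children q d ss (++⁻ʳ (entries v (suc d) cs) es)
                     (++⁻ʳ (labels cs) q∉ ∷ unique-++ʳ (labels cs) u) j

    unique-nb : ∀ v → Unique (nb v)
    unique-nb v with covers v
    ... | here refl = subst Unique (≡-sym (cong proj₂ info-root)) (unique-roots F (AllPairs.tail unique))
    ... | there i = unique-children r 1 F agrees unique i

    deg≡length : ∀ v → deg tree v ≡ length (nb v)
    deg≡length v = trans (deg≡# tree v) (≤-antisym
      (#≤length (adj tree v) (nb v) (λ u → adj⇒∈))
      (unique-length≤# (adj tree v) (unique-nb v) (All.tabulate ∈⇒adj)))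

    ∈-leaves-children : ∀ v cs ss {u} → u ∈ leaves cs → u ∈ leaves {n} (cons v cs ss)
    ∈-leaves-children v (cons _ _ _) ss i = ∈-++⁺ˡ i

    ∈-leaves-siblings : ∀ v cs ss {u} → u ∈ leaves ss → u ∈ leaves {n} (cons v cs ss)
    ∈-leaves-siblings v nil            ss i = there i
    ∈-leaves-siblings v cs@(cons _ _ _) ss i = ∈-++⁺ʳ (leaves cs) i

    -- No children leave only the parent as neighbour, a single child is excluded by `Branching`,
    -- and two or more give degree at least 3.
    children-shape : ∀ q d E → Agrees q d E → Branching E → ∀ {u} → u ∈ labels E →
      (u ∈ leaves E × length (nb u) ≡ 1) ⊎ 3 ≤ length (nb u)
    children-shape q d (cons v nil ss) (e ∷ es) _ (here refl) = inj₁ (here refl , cong (length ∘ proj₂) e)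
    children-shape q d (cons v (cons _ _ nil) ss) (e ∷ es) (ne , _) (here refl) = contradiction refl ne
    children-shape q d (cons v (cons _ _ (cons _ _ _)) ss) (e ∷ es) _ (here refl) =
      inj₂ (subst (λ a → 3 ≤ length (proj₂ a)) (≡-sym e) (s≤s (s≤s (s≤s z≤n))))
    children-shape q d (cons v cs ss) (e ∷ es) (_ , b , b′) (there i) with ∈-++⁻ (labels cs) i
    ... | inj₁ j with children-shape v (suc d) cs (++⁻ˡ _ es) b j
    ...   | inj₁ (l , e₁) = inj₁ (∈-leaves-children v cs ss l , e₁)
    ...   | inj₂ h        = inj₂ h
    children-shape q d (cons v cs ss) (e ∷ es) (_ , b , b′) (there i) | inj₂ j
      with children-shape q d ss (++⁻ʳ (entries v (suc d) cs) es) b′ j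
    ...   | inj₁ (l , e₁) = inj₁ (∈-leaves-siblings v cs ss l , e₁)
    ...   | inj₂ h        = inj₂ h

    shape : ∀ v → (v ∈ leaves F × length (nb v) ≡ 1) ⊎ 3 ≤ length (nb v)
    shape v with covers v
    ... | here refl = inj₂ (≤-trans 3≤roots (≤-reflexive (cong (length ∘ proj₂) (≡-sym info-root))))
    ... | there i   = children-shape r 1 F agrees branching i

    isHIT : IsHIT tree
    isHIT = (connected , acyclic) , λ v e → not-two v (trans (≡-sym (deg≡length v)) e)
      where
      not-two : ∀ v → length (nb v) ≢ 2
      not-two v e with shape v
      ... | inj₁ (_ , e′) = contradiction (trans (≡-sym e′) e) λ ()
      ... | inj₂ 3≤ = <-irrefl (≡-sym e) 3≤

    leaf-∈ : ∀ {v} → Leaf tree v → v ∈ leaves F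
    leaf-∈ {v} l with shape v
    ... | inj₁ (i , _) = i
    ... | inj₂ 3≤ = contradiction (trans (≡-sym (deg≡length v)) l)
        (λ e → <-irrefl (≡-sym e) (≤-trans (s≤s (s≤s z≤n)) 3≤))

    -- The rotation system and the order of the leaves

    ρ : Fin n → Fin n → Fin n
    -- Since `nb v` lists the parent first and then the children in order, tracing the face is a
    -- depth-first traversal, which meets the leaves in the order of `leaves F`.
    ρ v = cyclicSuc (nb v)

    isRotation : IsRotation tree ρ
    isRotation v = (λ u a → ∈⇒adj (cyclicSuc-∈ (nb v) (adj⇒∈ a))) ,
      λ u w a b → cyclicSuc-transitive (nb v) (unique-nb v) (adj⇒∈ a) (adj⇒∈ b)

    Dart : Set
    Dart = Fin n × Fin n

    -- The last component of `LeafSucc`, freed from starting at a leaf so that it can be built up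
    -- dart by dart.
    NextLeaf : Dart → Fin n → Set
    NextLeaf d z = Σ ℕ λ k → proj₂ (iterate (nextDart ρ) k d) ≡ z × Leaf tree z ×
      (∀ j → j < k → ¬ Leaf tree (proj₂ (iterate (nextDart ρ) j d)))

    nextLeaf-here : ∀ {u v} → Leaf tree v → NextLeaf (u , v) v
    nextLeaf-here l = 0 , refl , l , λ _ ()

    nextLeaf-skip : ∀ {u v z} → ¬ Leaf tree v → NextLeaf (v , ρ v u) z → NextLeaf (u , v) z
    nextLeaf-skip {u} {v} ¬l (k , e , l , before) =
      suc k , trans (cong proj₂ (≡-sym (iterate-shift (nextDart ρ) k (u , v)))) e , l ,
      λ { zero _ → ¬l ; (suc j) (s≤s j<k) → subst (¬_ ∘ Leaf tree ∘ proj₂)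
            (iterate-shift (nextDart ρ) j (u , v)) (before j j<k) }

    nextLeaf-unique : ∀ {d z z′} → NextLeaf d z → NextLeaf d z′ → z ≡ z′
    nextLeaf-unique (k , refl , l , b) (k′ , refl , l′ , b′) with <-cmp k k′
    ... | tri< k<k′ _ _ = contradiction l (b′ k k<k′)
    ... | tri≈ _ refl _ = refl
    ... | tri> _ _ k′<k = contradiction l′ (b k′ k′<k)

    -- A leaf has only one neighbour, so the starting dart is determined, and the first leaf met
    -- from it is unique.
    leafSucc-unique : ∀ {u z z′} → LeafSucc tree ρ u z → LeafSucc tree ρ u z′ → z ≡ z′
    leafSucc-unique {u} {z} (l , p , a , nl) (_ , p′ , a′ , nl′) =
      nextLeaf-unique nl (subst (λ p → NextLeaf (u , p) _)
        (single-∈ (nb u) (trans (≡-sym (deg≡length u)) l) (adj⇒∈ a′) (adj⇒∈ a)) nl′)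
      where
      single-∈ : ∀ (xs : List (Fin n)) {x y} → length xs ≡ 1 → x ∈ xs → y ∈ xs → x ≡ y
      single-∈ (x ∷ []) _ (here refl) (here refl) = refl

    -- Trace d ls d′ : following the face from d, the heads of the darts after d up to d′ run
    -- through exactly the leaves ls.
    data Trace : Dart → List (Fin n) → Dart → Set where
      []   : ∀ {d} → Trace d [] d
      leaf : ∀ {u v w ls d} → ρ v u ≡ w → Leaf tree w → Adj tree w v →
        Trace (v , w) ls d → Trace (u , v) (w ∷ ls) d
      skip : ∀ {u v w ls d} → ρ v u ≡ w → ¬ Leaf tree w → Trace (v , w) ls d → Trace (u , v) ls d

    _++ᵗ_ : ∀ {d d′ d″ xs ys} → Trace d xs d′ → Trace d′ ys d″ → Trace d (xs ++ ys) d″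
    []           ++ᵗ t′ = t′
    leaf e l a t ++ᵗ t′ = leaf e l a (t ++ᵗ t′)
    skip e l t   ++ᵗ t′ = skip e l (t ++ᵗ t′)

    -- `m` is the last neighbour in the list, from which the rotation returns to the first one.
    orbit : ∀ v {x xs} → nb v ≡ x ∷ xs → ∃ λ m → Walk (λ a b → ρ v a ≡ b) x xs m × ρ v m ≡ x
    orbit v {x} {xs} e = proj₂ (unsnoc xs
      (subst (λ l → Walk (λ a b → cyclicSuc l a ≡ b) x (xs ∷ʳ x) x) (≡-sym e)
        (cyclicSuc-walk (subst Unique e (unique-nb v)))))

    -- Around `q`, from the neighbour `u` to the neighbour `z`, the face enters the subtrees of `E`
    -- one after the other and comes back to `q` after each. At a leaf it turns back at once,
    -- because `q` is its only neighbour.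
    traverse : ∀ q u z d E → Agrees q d E → Branching E → (∀ {w} → w ∈ roots E → ¬ Leaf tree q) →
      Walk (λ a b → ρ q a ≡ b) u (roots E) z → Trace (u , q) (leaves E) (z , q)
    traverse q u z d nil _ _ _ [] = []
    traverse q u z d (cons v nil ss) (e ∷ es) (_ , _ , b) inner (ρu ∷ w) =
      leaf ρu (trans (deg≡length v) (cong (length ∘ proj₂) e)) (∈⇒adj (subst (λ a → q ∈ proj₂ a) (≡-sym e) (here refl)))
        (skip (cong (λ a → cyclicSuc (proj₂ a) q) e) (inner (here refl))
          (traverse q v z d ss es b (inner ∘ there) w))
    traverse q u z d (cons v cs@(cons _ _ _) ss) (e ∷ es) (_ , b , b′) inner (ρu ∷ w) =
      let m , w′ , ρm = orbit v (cong proj₂ e)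
          ¬leaf-v = λ l → contradiction (trans (≡-sym (cong (length ∘ proj₂) e)) (trans (≡-sym (deg≡length v)) l)) λ ()
      in skip ρu ¬leaf-v
           (traverse v q m (suc d) cs (++⁻ˡ _ es) b (λ _ → ¬leaf-v) w′
            ++ᵗ skip ρm (inner (here refl))
              (traverse q v z d ss (++⁻ʳ (entries v (suc d) cs) es) b′ (inner ∘ there) w))

    trace-first : ∀ {d ls d′ z} → Trace d (z ∷ ls) d′ → NextLeaf (nextDart ρ d) z
    trace-first (leaf refl l _ t) = nextLeaf-here l
    trace-first (skip refl l t)   = nextLeaf-skip l (trace-first t)

    trace-none : ∀ {d d′ z} → Trace d [] d′ → NextLeaf (nextDart ρ d′) z → NextLeaf (nextDart ρ d) z
    trace-none []              nl = nl
    trace-none (skip refl l t) nl = nextLeaf-skip l (trace-none t nl)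

    -- Between two consecutive listed leaves the trace has only `skip`s, so the second is the first
    -- leaf met after the first. The successor of the last leaf is found by going on beyond `d′`.
    trace-pairs : ∀ {d a ls d′ z} → Trace d (a ∷ ls) d′ → NextLeaf (nextDart ρ d′) z →
      All (λ (x , y) → LeafSucc tree ρ x y) (pairs a ls z)
    trace-pairs (skip e l t) nl = trace-pairs t nl
    trace-pairs {ls = []} (leaf {v = v} {w} e l a t) nl =
      (l , ρ w v , proj₁ (isRotation w) v a , trace-none t nl) ∷ []
    trace-pairs {ls = b ∷ ls} (leaf {v = v} {w} e l a t) nl =
      (l , ρ w v , proj₁ (isRotation w) v a , trace-first t) ∷ trace-pairs t nl

    root-not-leaf : ¬ Leaf tree r
    root-not-leaf l with subst (3 ≤_) {length (roots F)}
      (trans (≡-sym (cong (length ∘ proj₂) info-root)) (trans (≡-sym (deg≡length r)) l)) 3≤roots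
    ... | s≤s ()

    full-trace : ∃ λ d → Trace d (leaves F) d
    full-trace = go F refl
      where
      go : ∀ E → E ≡ F → ∃ λ d → Trace d (leaves E) d
      go nil refl = contradiction 3≤roots λ ()
      go E@(cons v cs ss) refl with orbit r (cong proj₂ info-root)
      -- `m` is the last child of the root and the rotation takes it to the first child, so the
      -- traversal ends at the dart where it began.
      ... | m , w , ρm = (m , r) , traverse r m m 1 E agrees branching (λ _ → root-not-leaf) (ρm ∷ w)

    module _ {x : Fin n} {xs : List (Fin n)} (leaves≡ : leaves F ≡ x ∷ xs) where

      cycle-pairs : List (Fin n × Fin n)
      cycle-pairs = pairs x xs x

      pairs-leafSucc : All (λ (a , b) → LeafSucc tree ρ a b) cycle-pairs
      pairs-leafSucc with full-trace
      ... | d , t with subst (λ l → Trace d l d) leaves≡ t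
      ...   | t′ = trace-pairs t′ (trace-first t′)

      -- The leaf `a` is the source of some pair of the cycle, and by `leafSucc-unique` its
      -- successor is the target of that pair.
      leafSucc-pairs : ∀ {a b} → LeafSucc tree ρ a b → (a , b) ∈ cycle-pairs
      leafSucc-pairs {a} s with pairs-source xs (subst (a ∈_) leaves≡ (leaf-∈ (proj₁ s)))
      ... | c , i = subst (λ y → (a , y) ∈ cycle-pairs) (leafSucc-unique (All.lookup pairs-leafSucc i) s) i

    -- Edges of the host graph and the Halin subgraph

    module _ (G : Graph n) (edges : EdgesIn G r F) where

      adj-roots : ∀ q E → EdgesIn G q E → ∀ {v} → v ∈ roots E → Adj G q v
      adj-roots q (cons v cs ss) (a , _)     (here refl) = a
      adj-roots q (cons v cs ss) (_ , _ , h) (there i)   = adj-roots q ss h i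

      adj-nb : ∀ q d E → Agrees q d E → EdgesIn G q E → ∀ {u} → u ∈ labels E → ∀ {v} → v ∈ nb u → Adj G u v
      adj-nb q d (cons v cs ss) (e ∷ es) (a , h , h′) (here refl) {w} j with subst (λ i → w ∈ proj₂ i) e j
      ... | here refl = adj-sym {G = G} a
      ... | there k   = adj-roots v cs h k
      adj-nb q d (cons v cs ss) (e ∷ es) (a , h , h′) (there i) j with ∈-++⁻ (labels cs) i
      ... | inj₁ k = adj-nb v (suc d) cs (++⁻ˡ _ es) h k j
      ... | inj₂ k = adj-nb q d ss (++⁻ʳ (entries v (suc d) cs) es) h′ k j

      tree⊆ : Subgraph tree G
      tree⊆ u v a with covers u
      ... | here refl = adj-roots r F edges (subst (λ i → v ∈ proj₂ i) info-root (adj⇒∈ a))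
      ... | there i   = adj-nb r 1 F agrees edges i (adj⇒∈ a)

    halin : ∀ {G : Graph n} {x xs} → 4 ≤ n → EdgesIn G r F → leaves F ≡ x ∷ xs →
      Walk (Adj G) x (xs ∷ʳ x) x → HasSpanningHalinSubgraph G
    halin {G} {x} {xs} 4≤n edges leaves≡ walk = H , H⊆G , 4≤n , tree , ρ , isHIT , isRotation ,
      λ u v → mk⇔ to-H from-H
      where
      open import Data.List.Membership.DecPropositional (≡-dec (_≟_ {n}) (_≟_ {n})) using () renaming (_∈?_ to _∈ᵖ?_)
      C : List (Fin n × Fin n)
      C = cycle-pairs leaves≡
      consecutive : Fin n → Fin n → Bool
      consecutive u v = ⌊ (u , v) ∈ᵖ? C ⌋
      adjH : Fin n → Fin n → Bool
      adjH u v = adj tree u v ∨ (consecutive u v ∨ consecutive v u)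
      C⊆G : All (λ (a , b) → Adj G a b) C
      C⊆G = pairs-walk xs walk
      case-H : ∀ {u v} → T (adjH u v) → Adj tree u v ⊎ (u , v) ∈ C ⊎ (v , u) ∈ C
      case-H {u} {v} t with to (T-∨ {adj tree u v}) t
      ... | inj₁ a = inj₁ a
      ... | inj₂ c with to (T-∨ {consecutive u v}) c
      ...   | inj₁ p = inj₂ (inj₁ (toWitness p))
      ...   | inj₂ p = inj₂ (inj₂ (toWitness p))
      adjH⊆ : ∀ {u v} → T (adjH u v) → Adj G u v
      adjH⊆ {u} {v} t with case-H t
      ... | inj₁ a        = tree⊆ G edges u v a
      ... | inj₂ (inj₁ i) = All.lookup C⊆G i
      ... | inj₂ (inj₂ i) = adj-sym {G = G} (All.lookup C⊆G i)
      H : Graph n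
      H = record
        { adj    = adjH
        ; sym    = λ u v → cong₂ _∨_ (sym tree u v) (∨-comm (consecutive u v) (consecutive v u))
        ; irrefl = λ v → ¬T⇒≡false (λ t → subst T (irrefl G v) (adjH⊆ t))
        }
      H⊆G : Subgraph H G
      H⊆G u v = adjH⊆
      to-H : ∀ {u v} → T (adjH u v) → Adj tree u v ⊎ LeafSucc tree ρ u v ⊎ LeafSucc tree ρ v u
      to-H t with case-H t
      ... | inj₁ a        = inj₁ a
      ... | inj₂ (inj₁ i) = inj₂ (inj₁ (All.lookup (pairs-leafSucc leaves≡) i))
      ... | inj₂ (inj₂ i) = inj₂ (inj₂ (All.lookup (pairs-leafSucc leaves≡) i))
      from-H : ∀ {u v} → Adj tree u v ⊎ LeafSucc tree ρ u v ⊎ LeafSucc tree ρ v u → T (adjH u v)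
      from-H {u} {v} (inj₁ a) = from (T-∨ {adj tree u v}) (inj₁ a)
      from-H {u} {v} (inj₂ c) = from (T-∨ {adj tree u v} {consecutive u v ∨ consecutive v u})
        (inj₂ (from (T-∨ {consecutive u v} {consecutive v u}) (consec c)))
        where
        consec : LeafSucc tree ρ u v ⊎ LeafSucc tree ρ v u → T (consecutive u v) ⊎ T (consecutive v u)
        consec (inj₁ s) = inj₁ (fromWitness (leafSucc-pairs leaves≡ s))
        consec (inj₂ s) = inj₂ (fromWitness (leafSucc-pairs leaves≡ s))

  -- Leaf-path spanning trees of one side

  unique-resp-↭ : ∀ {A : Set} {xs ys : List A} → xs ↭ ys → Unique xs → Unique ys
  unique-resp-↭ {A} perm = Permutation.Unique-resp-↭ (setoid A) (↭⇒↭ₛ perm)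

  -- One half of the final tree: `two-roots` gives `r` degree 3 once it is joined to the root of the
  -- other side, and the leaf path has prescribed ends so that cross edges can close it into a
  -- cycle.
  record SideForest {n : ℕ} (G : Graph n) (A : Fin n → Bool) (r first final : Fin n) : Set where
    field
      forest    : Forest n
      distinct  : Unique (r ∷ labels forest)
      inside    : All (T ∘ A) (labels forest)
      spanning  : ∀ {v} → T (A v) → v ∈ r ∷ labels forest
      edges     : EdgesIn G r forest
      branching : Branching forest
      two-roots : length (roots forest) ≡ 2
      others    : List (Fin n)
      leaves≡   : leaves forest ≡ first ∷ others
      leaf-walk : Walk (Adj G) first others final

  -- `C` is the almost complete core of the side `A`. The number `t` bounds both the non-neighbours
  -- in the core of a core vertex and the vertices of `A` outside the core; `D` bounds the core
  -- degrees from below and is large enough for all greedy choices.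
  module Side {n : ℕ} (G : Graph n) (A C : Fin n → Bool) (t D : ℕ)
    (C⊆A : ∀ {v} → T (C v) → T (A v))
    (dense : ∀ {v} → T (C v) → # (λ u → C u ∧ not (adj G v u)) ≤ t)
    (rich : ∀ {v} → T (A v) → D ≤ # (λ u → C u ∧ adj G v u))
    (few : # (λ v → A v ∧ not (C v)) ≤ t)
    (large : 10 * t + 13 < D) where

    -- Greedy choice of core vertices

    open import Data.List.Membership.DecPropositional (_≟_ {n}) using (_∈?_)

    -- Among at least `D` core neighbours of a vertex, `m` may be taken and `2 * t` may miss one of
    -- two further core vertices; one candidate is left.
    record Room (m : ℕ) : Set where
      constructor room
      field bound : m + 2 * t < D

    room-≤ : ∀ {m k} → k ≤ m → Room m → Room k
    room-≤ k≤m (room h) = room (≤-trans (s≤s (+-monoˡ-≤ (2 * t) k≤m)) h)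

    -- Restricting `P` to the neighbours of one core vertex `y` loses at most `t` candidates, so
    -- each entry of `ys` costs `t`.
    pick-common : ∀ (P : Fin n → Bool) → (∀ {v} → T (P v) → T (C v)) → ∀ ys used → All (T ∘ C) ys →
      length used + length ys * t < # P → ∃ λ v → T (P v) × All (λ y → Adj G y v) ys × v ∉ used
    pick-common P P⊆C [] used [] h with pick P used (subst (_< # P) (+-identityʳ _) h)
    ... | v , Pv , v∉ = v , Pv , [] , v∉
    pick-common P P⊆C (y ∷ ys) used (cy ∷ cys) h
      with pick-common (λ v → P v ∧ adj G y v) (λ t → P⊆C (proj₁ (to T-∧ t))) ys used cys (+-cancelʳ-≤ t _ _ bound)
      where
      open ≤-Reasoning
      bound : suc (length used + length ys * t) + t ≤ # (λ v → P v ∧ adj G y v) + t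
      bound = begin
        suc (length used + length ys * t) + t
          ≡⟨ cong suc (trans (+-assoc (length used) _ t) (cong (length used +_) (+-comm _ t))) ⟩
        suc (length used + length (y ∷ ys) * t) ≤⟨ h ⟩
        # P ≡⟨ #-split P (adj G y) ⟩
        # (λ v → P v ∧ adj G y v) + # (λ v → P v ∧ not (adj G y v))
          ≤⟨ +-monoʳ-≤ _ (≤-trans (#-mono _ (λ v → C v ∧ not (adj G y v))
               (λ v Pv → from T-∧ (P⊆C (proj₁ (to (T-∧ {P v}) Pv)) , proj₂ (to (T-∧ {P v}) Pv)))) (dense cy)) ⟩
        # (λ v → P v ∧ adj G y v) + t ∎
    ... | v , Pv , adjs , v∉ = v , proj₁ (to T-∧ Pv) , proj₂ (to (T-∧ {P v}) Pv) ∷ adjs , v∉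

    Chosen : Fin n → Fin n → Fin n → List (Fin n) → Set
    Chosen x y z used = ∃ λ v → T (C v) × Adj G x v × Adj G y v × Adj G z v × v ∉ used

    choose-among : ∀ x ys used → T (A x) → All (T ∘ C) ys → length ys ≤ 2 → Room (length used) →
      ∃ λ v → T (C v) × Adj G x v × All (λ y → Adj G y v) ys × v ∉ used
    choose-among x ys used ax cys ≤2 (room h)
      with pick-common (λ u → C u ∧ adj G x u) (λ {v} t → proj₁ (to (T-∧ {C v}) t)) ys used cys
        (≤-trans (s≤s (+-monoʳ-≤ (length used) (*-monoˡ-≤ t ≤2))) (≤-trans h (rich ax)))
    ... | v , cv , adjs , v∉ = v , proj₁ (to (T-∧ {C v}) cv) , proj₂ (to (T-∧ {C v}) cv) , adjs , v∉

    choose₁ : ∀ x used → T (A x) → Room (length used) → ∃ λ v → T (C v) × Adj G x v × v ∉ used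
    choose₁ x used ax rm with choose-among x [] used ax [] z≤n rm
    ... | v , cv , xv , [] , v∉ = v , cv , xv , v∉

    -- Only `x` may lie outside the core. Repeating an argument asks for fewer adjacencies.
    choose : ∀ x y z used → T (A x) → T (C y) → T (C z) → Room (length used) → Chosen x y z used
    choose x y z used ax cy cz rm with choose-among x (y ∷ z ∷ []) used ax (cy ∷ cz ∷ []) ≤-refl rm
    ... | v , cv , xv , yv ∷ zv ∷ [] , v∉ = v , cv , xv , yv , zv , v∉

    -- Chains of fans

    record Fan : Set where
      constructor fan
      field
        -- The first two leaves are kept apart because later vertices are inserted between them;
        -- `Chain` demands that they and the hub lie in the core.
        hub left middle : Fin n
        others : List (Fin n)

    vertices : List Fan → List (Fin n)
    vertices []                   = []
    vertices (fan p l m xs ∷ fs) = p ∷ l ∷ m ∷ xs ++ vertices fs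

    -- Chain q e fs z: the hubs of fs continue a path that has reached q, their leaves continue a
    -- path that has reached e, and the leaf path ends at z.
    data Chain : Fin n → Fin n → List Fan → Fin n → Set where
      []   : ∀ {q e} → Chain q e [] e
      link : ∀ {q e p l m xs e′ fs z} → Adj G q p → All (Adj G p) (l ∷ m ∷ xs) →
        T (C p) → T (C l) → T (C m) →
        Walk (Adj G) e (l ∷ m ∷ xs) e′ → Chain p e′ fs z → Chain q e (fan p l m xs ∷ fs) z

    -- `used` holds the vertices already placed or reserved, and `required` the reserved ones whose
    -- turn comes within `vs`.
    record Extends (used required vs : List (Fin n)) : Set where
      field
        unique  : Unique vs
        fresh   : ∀ {v} → v ∈ vs → v ∈ used → v ∈ required
        inside  : All (T ∘ A) vs
        covered : ∀ {v} → v ∈ required → v ∈ vs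
    open Extends

    unique-∷ : ∀ {v : Fin n} {vs} → v ∉ vs → Unique vs → Unique (v ∷ vs)
    unique-∷ v∉ u = ¬Any⇒All¬ _ v∉ ∷ u

    head∉ : ∀ {v : Fin n} {vs} → Unique (v ∷ vs) → v ∉ vs
    head∉ (v∉ ∷ _) = All¬⇒¬Any v∉

    extend-fresh : ∀ {used required vs a} → T (C a) → a ∉ used → (∀ {v} → v ∈ required → v ∈ used) →
      Extends (a ∷ used) required vs → Extends used required (a ∷ vs)
    extend-fresh ca a∉ req⊆ ext = record
      { unique  = unique-∷ (λ i → a∉ (req⊆ (fresh ext i (here refl)))) (unique ext)
      ; fresh   = λ { (here refl) u → contradiction u a∉ ; (there i) u → fresh ext i (there u) }
      ; inside  = C⊆A ca ∷ inside ext
      ; covered = there ∘ covered ext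
      }

    -- The end `z` of the leaf path stays at the front of the list, since it is placed last; `x` is
    -- taken from behind it.
    extend-required : ∀ {used z x xs vs} → T (A x) → x ∉ z ∷ xs → x ∈ used →
      Extends used (z ∷ xs) vs → Extends used (z ∷ x ∷ xs) (x ∷ vs)
    extend-required {z = z} {x} {xs} ax x∉ x∈ ext = record
      { unique  = unique-∷ (λ i → x∉ (fresh ext i x∈)) (unique ext)
      ; fresh   = λ { (here refl) u → there (here refl) ; (there i) u → weaken (fresh ext i u) }
      ; inside  = ax ∷ inside ext
      ; covered = λ { (here e) → there (covered ext (here e)) ; (there (here e)) → here e
                    ; (there (there i)) → there (covered ext (there i)) }
      }
      where
      weaken : ∀ {v} → v ∈ z ∷ xs → v ∈ z ∷ x ∷ xs
      weaken (here e)  = here e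
      weaken (there i) = there (there i)

    extends-last : ∀ {used z} → T (A z) → Extends used (z ∷ []) (z ∷ [])
    extends-last az = record
      { unique = [] ∷ [] ; fresh = λ i _ → i ; inside = az ∷ [] ; covered = λ i → i }

    -- Fresh vertices still to be chosen: three for a plain fan, four for a fan through an
    -- exceptional vertex, three for the last fan.
    need : ℕ → List (Fin n) → ℕ
    need zero    []       = 3
    need zero    (x ∷ xs) = 4 + need zero xs
    need (suc k) xs       = 3 + need k xs

    +-shift : ∀ a b c → b + (a + c) ≡ a + (b + c)
    +-shift = solve-∀

    record Built (q e z : Fin n) (k : ℕ) (used required : List (Fin n)) : Set where
      constructor built
      field
        fans    : List Fan
        chain   : Chain q e fans z
        long    : k < length fans
        extends : Extends used required (vertices fans)

    -- The rest of the chain comes from a continuation, because it has to avoid the three vertices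
    -- chosen here.
    plain-link : ∀ {q e z k used required} → T (A q) → T (C e) → Room (2 + length used) →
      (∀ {v} → v ∈ required → v ∈ used) →
      (∀ {p m used′} → T (C p) → T (C m) → length used′ ≡ 3 + length used → (∀ {v} → v ∈ used → v ∈ used′) →
        Built p m z k used′ required) →
      Built q e z (suc k) used required
    plain-link {q} {e} {used = used} aq ce rm req⊆ continue =
      choose₁ q used aq (room-≤ (m≤n+m _ 2) rm) |>′ λ (p , cp , qp , p∉) →
      choose p e e (p ∷ used) (C⊆A cp) ce ce (room-≤ (m≤n+m _ 1) rm) |>′ λ (l , cl , pl , el , _ , l∉) →
      choose p l l (l ∷ p ∷ used) (C⊆A cp) cl cl rm |>′ λ (m , cm , pm , lm , _ , m∉) →
      continue {used′ = m ∷ l ∷ p ∷ used} cp cm refl (there ∘ there ∘ there) |>′ λ (built fs ch long ext) →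
      built (fan p l m [] ∷ fs)
        (link qp (pl ∷ pm ∷ []) cp cl cm (el ∷ lm ∷ []) ch) (s≤s long)
        (extend-fresh cp p∉ req⊆ (extend-fresh cl l∉ (there ∘ req⊆) (extend-fresh cm m∉ (there ∘ there ∘ req⊆) ext)))

    -- As `z` may lie outside the core, its hub and the leaf before it are picked among its own core
    -- neighbours.
    final-link : ∀ {q e z used} → T (C q) → T (C e) → T (A z) → z ∈ used → Room (2 + length used) →
      Built q e z 0 used (z ∷ [])
    final-link {q} {e} {z} {used} cq ce az z∈ rm =
      choose z q q used az cq cq (room-≤ (m≤n+m _ 2) rm) |>′ λ (p , cp , zp , qp , _ , p∉) →
      choose p e e (p ∷ used) (C⊆A cp) ce ce (room-≤ (m≤n+m _ 1) rm) |>′ λ (l , cl , pl , el , _ , l∉) →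
      choose z p l (l ∷ p ∷ used) az cp cl rm |>′ λ (m , cm , zm , pm , lm , m∉) →
      built (fan p l m (z ∷ []) ∷ [])
        (link qp (pl ∷ pm ∷ adj-sym {G = G} zp ∷ []) cp cl cm (el ∷ lm ∷ adj-sym {G = G} zm ∷ []) []) (s≤s z≤n)
        (extend-fresh cp p∉ req⊆ (extend-fresh cl l∉ (there ∘ req⊆) (extend-fresh cm m∉ (there ∘ there ∘ req⊆)
          (extends-last az))))
      where
      req⊆ : ∀ {v} → v ∈ z ∷ [] → v ∈ used
      req⊆ (here refl) = z∈

    -- The hub and the leaves on both sides of `x` are picked among the core neighbours of `x`; the
    -- leaf `k` after it brings the path back to the core.
    visit-link : ∀ {q e z x xs used} → T (C q) → T (C e) → T (A x) → x ∉ z ∷ xs → Room (3 + length used) →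
      (∀ {v} → v ∈ z ∷ x ∷ xs → v ∈ used) →
      (∀ {p k used′} → T (C p) → T (C k) → length used′ ≡ 4 + length used → (∀ {v} → v ∈ used → v ∈ used′) →
        Built p k z 0 used′ (z ∷ xs)) →
      Built q e z 0 used (z ∷ x ∷ xs)
    visit-link {q} {e} {z} {x} {xs} {used} cq ce ax x∉ rm req⊆ continue =
      choose x q q used ax cq cq (room-≤ (m≤n+m _ 3) rm) |>′ λ (p , cp , xp , qp , _ , p∉) →
      choose p e e (p ∷ used) (C⊆A cp) ce ce (room-≤ (m≤n+m _ 2) rm) |>′ λ (l , cl , pl , el , _ , l∉) →
      choose x p l (l ∷ p ∷ used) ax cp cl (room-≤ (m≤n+m _ 1) rm) |>′ λ (m , cm , xm , pm , lm , m∉) →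
      choose x p p (m ∷ l ∷ p ∷ used) ax cp cp rm |>′ λ (k , ck , xk , pk , _ , k∉) →
      continue {used′ = k ∷ m ∷ l ∷ p ∷ used} cp ck refl (there ∘ there ∘ there ∘ there) |>′ λ (built fs ch long ext) →
      built (fan p l m (x ∷ k ∷ []) ∷ fs)
        (link qp (pl ∷ pm ∷ adj-sym {G = G} xp ∷ pk ∷ []) cp cl cm (el ∷ lm ∷ adj-sym {G = G} xm ∷ xk ∷ []) ch) (s≤s z≤n)
        (extend-fresh cp p∉ req⊆ (extend-fresh cl l∉ (there ∘ req⊆) (extend-fresh cm m∉ (there ∘ there ∘ req⊆)
          (extend-required ax x∉ (there (there (there (req⊆ (there (here refl))))))
            (extend-fresh ck k∉ (there ∘ there ∘ there ∘ req⊆ ∘ skip-x) ext)))))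
      where
      skip-x : ∀ {v} → v ∈ z ∷ xs → v ∈ z ∷ x ∷ xs
      skip-x (here i)  = here i
      skip-x (there i) = there (there i)

    -- First come `k` plain fans, which provide places for insertions, then one fan for each
    -- exceptional vertex, and a last one ending in `z`.
    build : ∀ k xs {q e z} used → T (C q) → T (C e) → All (T ∘ A) (z ∷ xs) → Unique (z ∷ xs) →
      (∀ {v} → v ∈ z ∷ xs → v ∈ used) → Room (need k xs + length used) → Built q e z k used (z ∷ xs)
    build (suc k) xs used cq ce ax u req⊆ rm =
      plain-link (C⊆A cq) ce (room-≤ (+-mono-≤ {2} {3} (s≤s (s≤s z≤n)) (m≤n+m _ (need k xs))) rm) req⊆
        λ {_} {_} {used′} cp cm len used⊆ → build k xs used′ cp cm ax u (used⊆ ∘ req⊆)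
          (subst Room (≡-sym (trans (cong (need k xs +_) len) (+-shift 3 (need k xs) (length used)))) rm)
    build zero [] used cq ce (az ∷ []) u req⊆ rm = final-link cq ce az (req⊆ (here refl)) (room-≤ (m≤n+m _ 1) rm)
    build zero (x ∷ xs) {z = z} used cq ce (az ∷ ax ∷ axs) ((z≢x ∷ z∉) ∷ (x∉ ∷ u)) req⊆ rm =
      visit-link cq ce ax x∉zxs (room-≤ (+-mono-≤ {3} {4} (s≤s (s≤s (s≤s z≤n))) (m≤n+m _ (need 0 xs))) rm) req⊆
        λ {_} {_} {used′} cp ck len used⊆ → build zero xs used′ cp ck (az ∷ axs) (z∉ ∷ u)
          (λ { (here i) → used⊆ (req⊆ (here i)) ; (there i) → used⊆ (req⊆ (there (there i))) })
          (subst Room (≡-sym (trans (cong (need zero xs +_) len) (+-shift 4 (need zero xs) (length used)))) rm)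
      where
      x∉zxs : x ∉ z ∷ xs
      x∉zxs (here e)  = z≢x (≡-sym e)
      x∉zxs (there i) = All¬⇒¬Any x∉ i

    -- Inserting the remaining core vertices

    Missed : Fin n → Fin n → Bool
    Missed v u = C u ∧ not (adj G v u)

    -- A fan that cannot take `v` has a hub, left or middle leaf missed by `v`; these witnesses are
    -- distinct because the fans are disjoint.
    insert-or-miss : ∀ v → T (C v) → ∀ {q e fs z} → Chain q e fs z → Unique (vertices fs) →
      (∃ λ fs′ → Chain q e fs′ z × v ∷ vertices fs ↭ vertices fs′ × length fs ≡ length fs′) ⊎
      (∃ λ us → length us ≡ length fs × Unique us × All (T ∘ Missed v) us × (∀ {u} → u ∈ us → u ∈ vertices fs))
    insert-or-miss v cv [] _ = inj₂ ([] , refl , [] , [] , λ i → i)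
    insert-or-miss v cv {fs = fan p l m xs ∷ fs} (link qp adjs cp cl cm w ch) u
      with insert-or-miss v cv ch (unique-++ʳ (p ∷ l ∷ m ∷ xs) u)
    ... | inj₁ (fs′ , ch′ , perm , len) = inj₁ (fan p l m xs ∷ fs′ , link qp adjs cp cl cm w ch′ ,
            ↭-trans (↭-sym (shift v (p ∷ l ∷ m ∷ xs) (vertices fs))) (++⁺ˡ (p ∷ l ∷ m ∷ xs) perm) , cong suc len)
    ... | inj₂ (us , len , uniq , missed , us⊆) with T? (adj G v p) | T? (adj G v l) | T? (adj G v m)
    ...   | no ¬p | _ | _ = inj₂ (p ∷ us , cong suc len ,
              unique-∷ (λ i → head∉ u (∈-++⁺ʳ (l ∷ m ∷ xs) (us⊆ i))) uniq , from T-∧ (cp , T-not ¬p) ∷ missed ,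
              λ { (here e) → here e ; (there i) → there (there (there (∈-++⁺ʳ xs (us⊆ i)))) })
    ...   | yes _ | no ¬l | _ = inj₂ (l ∷ us , cong suc len ,
              unique-∷ (λ i → head∉ (AllPairs.tail u) (∈-++⁺ʳ (m ∷ xs) (us⊆ i))) uniq , from T-∧ (cl , T-not ¬l) ∷ missed ,
              λ { (here e) → there (here e) ; (there i) → there (there (there (∈-++⁺ʳ xs (us⊆ i)))) })
    ...   | yes _ | yes _ | no ¬m = inj₂ (m ∷ us , cong suc len ,
              unique-∷ (λ i → head∉ (AllPairs.tail (AllPairs.tail u)) (∈-++⁺ʳ xs (us⊆ i))) uniq ,
              from T-∧ (cm , T-not ¬m) ∷ missed ,
              λ { (here e) → there (there (here e)) ; (there i) → there (there (there (∈-++⁺ʳ xs (us⊆ i)))) })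
    -- `v` becomes the middle leaf and the old one moves to the others, so the first two leaves are
    -- again core vertices.
    ...   | yes vp | yes vl | yes vm = inj₁ (fan p l v (m ∷ xs) ∷ fs , link qp (splice-all adjs) cp cl cv (splice w) ch ,
              ↭-sym (shift v (p ∷ l ∷ []) _) , refl)
      where
      splice-all : All (Adj G p) (l ∷ m ∷ xs) → All (Adj G p) (l ∷ v ∷ m ∷ xs)
      splice-all (a ∷ as) = a ∷ adj-sym {G = G} vp ∷ as
      splice : ∀ {e e′} → Walk (Adj G) e (l ∷ m ∷ xs) e′ → Walk (Adj G) e (l ∷ v ∷ m ∷ xs) e′
      splice (a ∷ _ ∷ w) = a ∷ adj-sym {G = G} vl ∷ vm ∷ w

    -- The triples of hub, left and middle leaves are disjoint, so at most t of the fans contain a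
    -- core vertex missed by v.
    insert : ∀ {q e z k used required} v → T (C v) → t ≤ k → (b : Built q e z k used required) →
      v ∉ used → v ∉ vertices (Built.fans b) →
      ∃ λ (b′ : Built q e z k used required) → v ∷ vertices (Built.fans b) ↭ vertices (Built.fans b′)
    insert v cv t≤k (built fs ch long ext) v∉used v∉ with insert-or-miss v cv ch (unique ext)
    ... | inj₂ (us , len , uniq , missed , _) = contradiction
            (≤-trans (≤-trans (s≤s t≤k) long)
              (≤-trans (≤-reflexive (≡-sym len)) (≤-trans (unique-length≤# (Missed v) uniq missed) (dense cv))))
            (<-irrefl refl)
    ... | inj₁ (fs′ , ch′ , perm , len) = built fs′ ch′ (subst (_ <_) len long) (record
            { unique  = unique-resp-↭ perm (unique-∷ v∉ (unique ext))
            ; fresh   = λ i j → fresh′ (∈-resp-↭ (↭-sym perm) i) j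
            ; inside  = All-resp-↭ perm (C⊆A cv ∷ inside ext)
            ; covered = λ i → ∈-resp-↭ perm (there (covered ext i))
            }) , perm
      where
      fresh′ : ∀ {w} → w ∈ v ∷ vertices fs → w ∈ _ → w ∈ _
      fresh′ (here refl) j = contradiction j v∉used
      fresh′ (there i)   j = fresh ext i j

    insert-all : ∀ {q e z k used required} vs → t ≤ k → (∀ {v} → T (A v) → v ∉ used → T (C v)) →
      (b : Built q e z k used required) →
      ∃ λ (b′ : Built q e z k used required) → (∀ {v} → v ∈ vertices (Built.fans b) → v ∈ vertices (Built.fans b′)) ×
        (∀ {v} → v ∈ vs → T (A v) → v ∈ used ⊎ v ∈ vertices (Built.fans b′))
    insert-all []       t≤k good b = b , (λ i → i) , λ ()
    insert-all {used = used} (v ∷ vs) t≤k good b with v ∈? used | v ∈? vertices (Built.fans b) | T? (A v)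
    ... | no v∉ | no v∉′ | yes av with insert v (good av v∉) t≤k b v∉ v∉′
    ...   | b₁ , perm with insert-all vs t≤k good b₁
    ...     | b₂ , ⊆₂ , all = b₂ , (λ i → ⊆₂ (∈-resp-↭ perm (there i))) ,
                λ { (here refl) _ → inj₂ (⊆₂ (∈-resp-↭ perm (here refl))) ; (there i) a → all i a }
    insert-all (v ∷ vs) t≤k good b | yes v∈ | _ | _ with insert-all vs t≤k good b
    ... | b′ , ⊆′ , all = b′ , ⊆′ , λ { (here refl) _ → inj₁ v∈ ; (there i) a → all i a }
    insert-all (v ∷ vs) t≤k good b | no _ | yes v∈ | _ with insert-all vs t≤k good b
    ... | b′ , ⊆′ , all = b′ , ⊆′ , λ { (here refl) _ → inj₂ (⊆′ v∈) ; (there i) a → all i a }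
    insert-all (v ∷ vs) t≤k good b | no _ | no _ | no ¬a with insert-all vs t≤k good b
    ... | b′ , ⊆′ , all = b′ , ⊆′ , λ { (here refl) a → contradiction a ¬a ; (there i) a → all i a }

    -- Each fan becomes its hub; the children of a hub are its leaves followed by the next hub.
    leafRow : List (Fin n) → Forest n → Forest n
    leafRow []       E = E
    leafRow (x ∷ xs) E = cons x nil (leafRow xs E)

    fanForest : List Fan → Forest n
    fanForest []                  = nil
    fanForest (fan p l m xs ∷ fs) = cons p (leafRow (l ∷ m ∷ xs) (fanForest fs)) nil

    labels-row : ∀ xs E → labels (leafRow xs E) ≡ xs ++ labels E
    labels-row []       E = refl
    labels-row (x ∷ xs) E = cong (x ∷_) (labels-row xs E)

    labels-fans : ∀ fs → labels (fanForest fs) ≡ vertices fs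
    labels-fans []                  = refl
    labels-fans (fan p l m xs ∷ fs) = cong (λ k → p ∷ l ∷ m ∷ k)
      (trans (++-identityʳ _) (trans (labels-row xs (fanForest fs)) (cong (xs ++_) (labels-fans fs))))

    leaves-row : ∀ xs E → leaves (leafRow xs E) ≡ xs ++ leaves E
    leaves-row []       E = refl
    leaves-row (x ∷ xs) E = cong (x ∷_) (leaves-row xs E)

    leaves-fans : ∀ {q e fs z} → Chain q e fs z → Walk (Adj G) e (leaves (fanForest fs)) z
    leaves-fans [] = []
    leaves-fans {e = e} {fan p l m xs ∷ fs} {z} (link _ _ _ _ _ w ch) =
      subst (λ k → Walk (Adj G) e k z)
        (≡-sym (trans (++-identityʳ _) (leaves-row (l ∷ m ∷ xs) (fanForest fs))))
        (w ++ʷ leaves-fans ch)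

    edges-row : ∀ {p} xs E → All (Adj G p) xs → EdgesIn G p E → EdgesIn G p (leafRow xs E)
    edges-row []       E []       h = h
    edges-row (x ∷ xs) E (a ∷ as) h = a , tt , edges-row xs E as h

    edges-fans : ∀ {q e fs z} → Chain q e fs z → EdgesIn G q (fanForest fs)
    edges-fans []                         = tt
    edges-fans {fs = fan p l m xs ∷ fs} (link qp as _ _ _ _ ch) =
      qp , edges-row (l ∷ m ∷ xs) (fanForest fs) as (edges-fans ch) , tt

    branching-row : ∀ xs E → Branching E → Branching (leafRow xs E)
    branching-row []       E b = b
    branching-row (x ∷ xs) E b = (λ ()) , tt , branching-row xs E b

    branching-fans : ∀ fs → Branching (fanForest fs)
    branching-fans []                  = tt
    branching-fans (fan p l m xs ∷ fs) =
      (λ ()) , branching-row (l ∷ m ∷ xs) (fanForest fs) (branching-fans fs) , tt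

    one-root : ∀ {k} fs → k < length fs → length (roots (fanForest fs)) ≡ 1
    one-root (_ ∷ _) _ = refl

    -- Assembling one side

    module _ {r a z : Fin n} (ar : T (A r)) (aa : T (A a)) (az : T (A z))
      (r≢a : r ≢ a) (r≢z : r ≢ z) (a≢z : a ≢ z) where

      Outside : Fin n → Bool
      Outside = (λ v → A v ∧ not (C v)) ∖ r ∖ a ∖ z

      -- All prescribed and exceptional vertices are reserved before the first choice, so fresh
      -- vertices never collide with them.
      xs used₀ : List (Fin n)
      xs    = filter (λ v → T? (Outside v)) (allFin n)
      used₀ = r ∷ a ∷ z ∷ xs

      ∈-xs⁻ : ∀ {v} → v ∈ xs → T (A v) × v ≢ r × v ≢ a × v ≢ z
      ∈-xs⁻ {v} i with ∈-∖⁻ {P = (λ v → A v ∧ not (C v)) ∖ r ∖ a}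
        (proj₂ (∈-filter⁻ (λ v → T? (Outside v)) {xs = allFin n} i))
      ... | i₁ , v≢z with ∈-∖⁻ {P = (λ v → A v ∧ not (C v)) ∖ r} i₁
      ...   | i₂ , v≢a with ∈-∖⁻ {P = λ v → A v ∧ not (C v)} i₂
      ...     | i₃ , v≢r = proj₁ (to (T-∧ {A v}) i₃) , v≢r , v≢a , v≢z

      core-or-used : ∀ {v} → T (A v) → v ∉ used₀ → T (C v)
      core-or-used {v} av v∉ with C v in eq
      ... | true  = tt
      ... | false = contradiction (there (there (there (∈-filter⁺ (λ v → T? (Outside v)) (∈-allFin v)
        (∈-∖⁺ {P = (λ v → A v ∧ not (C v)) ∖ r ∖ a} (∈-∖⁺ {P = (λ v → A v ∧ not (C v)) ∖ r} (∈-∖⁺ {P = λ v → A v ∧ not (C v)}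
          (from T-∧ (av , T-not (λ c → subst T eq c))) (λ e → v∉ (here e))) (λ e → v∉ (there (here e))))
          (λ e → v∉ (there (there (here e)))))))))
        v∉

      xs≤t : length xs ≤ t
      xs≤t = begin
        length xs                  ≡⟨ length-filter-tabulate Outside (λ v → v) ⟩
        # Outside                  ≤⟨ #-mono Outside (λ v → A v ∧ not (C v)) (λ v o →
          proj₁ (∈-∖⁻ {P = λ v → A v ∧ not (C v)} (proj₁ (∈-∖⁻ {P = (λ v → A v ∧ not (C v)) ∖ r}
            (proj₁ (∈-∖⁻ {P = (λ v → A v ∧ not (C v)) ∖ r ∖ a} o)))))) ⟩
        # (λ v → A v ∧ not (C v))  ≤⟨ few ⟩
        t                          ∎
        where open ≤-Reasoning

      need≡ : ∀ k ys → need k ys ≡ 3 * k + (4 * length ys + 3)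
      need≡ zero    []       = refl
      need≡ zero    (y ∷ ys) = trans (cong (4 +_) (need≡ zero ys)) (eq (length ys))
        where
        eq : ∀ m → 4 + (4 * m + 3) ≡ 4 * suc m + 3
        eq = solve-∀
      need≡ (suc k) ys       = trans (cong (3 +_) (need≡ k ys)) (eq k (4 * length ys + 3))
        where
        eq : ∀ k m → 3 + (3 * k + m) ≡ 3 * suc k + m
        eq = solve-∀

      -- The 10 counts `r`, `a`, `z`, the four vertices opening the forest and the three of the
      -- plain fan after them. As `xs` has at most `t` entries, the sum is at most `8 * t + 13`, and
      -- `Room` adds `2 * t`.
      total-room : Room (need t xs + (10 + length xs))
      total-room = room (≤-trans (s≤s (begin
        need t xs + (10 + length xs) + 2 * t                      ≡⟨ cong (λ k → k + (10 + length xs) + 2 * t) (need≡ t xs) ⟩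
        3 * t + (4 * length xs + 3) + (10 + length xs) + 2 * t    ≤⟨ +-monoˡ-≤ (2 * t) (+-mono-≤
          (+-monoʳ-≤ (3 * t) (+-monoˡ-≤ 3 (*-monoʳ-≤ 4 xs≤t))) (+-monoʳ-≤ 10 xs≤t)) ⟩
        3 * t + (4 * t + 3) + (10 + t) + 2 * t                    ≡⟨ eq t ⟩
        10 * t + 13                                               ∎)) large)
        where
        open ≤-Reasoning
        eq : ∀ t → 3 * t + (4 * t + 3) + (10 + t) + 2 * t ≡ 10 * t + 13
        eq = solve-∀

      small-room : ∀ k → k ≤ 10 → Room (k + length xs)
      small-room k k≤10 = room-≤ (≤-trans (+-monoˡ-≤ (length xs) k≤10) (m≤n+m _ (need t xs))) total-room

      unique-required : Unique (z ∷ xs)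
      unique-required = unique-∷ (λ i → proj₂ (proj₂ (proj₂ (∈-xs⁻ i))) refl)
        (filter⁺ (λ v → T? (Outside v)) (allFin⁺ n))

      required-inside : All (T ∘ A) (z ∷ xs)
      required-inside = az ∷ All.tabulate (proj₁ ∘ ∈-xs⁻)

      a∉required : a ∉ z ∷ xs
      a∉required (here q)  = a≢z q
      a∉required (there i) = proj₁ (proj₂ (proj₂ (∈-xs⁻ i))) refl

      r∉required : r ∉ z ∷ a ∷ xs
      r∉required (here q)          = r≢z q
      r∉required (there (here q))  = r≢a q
      r∉required (there (there i)) = proj₁ (proj₂ (∈-xs⁻ i)) refl

      -- Outside the core, r and a need not have a common neighbour, so two core vertices g and f
      -- lead from r to the leaf a; g gets the leaf e as its second child, and f the leaf c.
      assemble : ∀ {g f c e} → T (C g) → T (C f) → T (C c) → T (C e) →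
        Adj G r g → Adj G g f → Adj G f a → Adj G f c → Adj G g e → Walk (Adj G) a (c ∷ e ∷ []) e →
        g ∉ used₀ → f ∉ g ∷ used₀ → c ∉ f ∷ g ∷ used₀ → e ∉ c ∷ f ∷ g ∷ used₀ →
        Built r e z (suc t) (e ∷ c ∷ f ∷ g ∷ used₀) (z ∷ xs) → SideForest G A r a z
      assemble {g} {f} {c} {e} cg cf cc ce rg gf fa fc ge ace g∉ f∉ c∉ e∉ b
        with insert-all (allFin n) (n≤1+n t) (λ av v∉ → core-or-used av (v∉ ∘ there ∘ there ∘ there ∘ there)) b
      ... | built fs ch long ext , _ , all = record
        { forest    = cons g (cons f (cons a nil (cons c nil nil)) (cons e nil nil)) (fanForest fs)
        ; distinct  = subst (λ l → Unique (r ∷ g ∷ f ∷ a ∷ c ∷ e ∷ l)) (≡-sym (labels-fans fs)) (unique whole)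
        ; inside    = subst (λ l → All (T ∘ A) (g ∷ f ∷ a ∷ c ∷ e ∷ l)) (≡-sym (labels-fans fs)) (All.tail (inside whole))
        ; spanning  = λ {v} av → subst (λ l → v ∈ r ∷ g ∷ f ∷ a ∷ c ∷ e ∷ l) (≡-sym (labels-fans fs))
            (place (all (∈-allFin v) av))
        ; edges     = rg , (gf , (fa , tt , fc , tt , tt) , ge , tt , tt) , edges-fans ch
        ; branching = (λ ()) , ((λ ()) , ((λ ()) , tt , (λ ()) , tt , tt) , ((λ ()) , tt , tt)) , branching-fans fs
        ; two-roots = cong suc (one-root fs long)
        ; others    = c ∷ e ∷ leaves (fanForest fs)
        ; leaves≡   = refl
        ; leaf-walk = ace ++ʷ leaves-fans ch
        }
        where
        z-or-xs : ∀ {v} → v ∈ z ∷ a ∷ xs → v ∈ used₀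
        z-or-xs (here q)          = there (there (here q))
        z-or-xs (there (here q))  = there (here q)
        z-or-xs (there (there i)) = there (there (there i))
        whole : Extends used₀ (z ∷ r ∷ a ∷ xs) (r ∷ g ∷ f ∷ a ∷ c ∷ e ∷ vertices fs)
        whole = extend-required ar r∉required (here refl)
          (extend-fresh cg g∉ z-or-xs (extend-fresh cf f∉ (there ∘ z-or-xs)
            (extend-required aa a∉required (there (there (there (here refl))))
              (extend-fresh cc c∉ (there ∘ there ∘ there ∘ there)
                (extend-fresh ce e∉ (there ∘ there ∘ there ∘ there ∘ there) ext)))))
        place : ∀ {v} → v ∈ e ∷ c ∷ f ∷ g ∷ used₀ ⊎ v ∈ vertices fs → v ∈ r ∷ g ∷ f ∷ a ∷ c ∷ e ∷ vertices fs
        place (inj₂ i) = there (there (there (there (there (there i)))))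
        place (inj₁ (here q)) = there (there (there (there (there (here q)))))
        place (inj₁ (there (here q))) = there (there (there (there (here q))))
        place (inj₁ (there (there (here q)))) = there (there (here q))
        place (inj₁ (there (there (there (here q))))) = there (here q)
        place (inj₁ (there (there (there (there (here q)))))) = covered whole (there (here q))
        place (inj₁ (there (there (there (there (there (here q))))))) = covered whole (there (there (here q)))
        place (inj₁ (there (there (there (there (there (there (here q)))))))) = covered whole (here q)
        place (inj₁ (there (there (there (there (there (there (there i)))))))) = covered whole (there (there (there i)))

      sideForest : SideForest G A r a z
      sideForest =
        choose₁ r used₀ ar (small-room 3 (m≤m+n 3 7)) |>′ λ (g , cg , rg , g∉) →
        choose a g g (g ∷ used₀) aa cg cg (small-room 4 (m≤m+n 4 6)) |>′ λ (f , cf , af , gf , _ , f∉) →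
        choose a f f (f ∷ g ∷ used₀) aa cf cf (small-room 5 (m≤m+n 5 5)) |>′ λ (c , cc , ac , fc , _ , c∉) →
        choose g c c (c ∷ f ∷ g ∷ used₀) (C⊆A cg) cc cc (small-room 6 (m≤m+n 6 4)) |>′ λ (e , ce , ge , ce′ , _ , e∉) →
        assemble cg cf cc ce rg gf (adj-sym {G = G} af) fc ge (ac ∷ ce′ ∷ []) g∉ f∉ c∉ e∉
          -- `build` starts from a core vertex, which `r` need not be, so one plain fan precedes it.
          (plain-link ar ce (small-room 9 (m≤m+n 9 1)) required-used
            (λ {_} {_} {used′} cp cm len used⊆ →
              build t xs used′ cp cm required-inside unique-required (used⊆ ∘ required-used)
              (subst (λ k → Room (need t xs + k)) (≡-sym len) total-room)))
        where
        required-used : ∀ {v e c f g} → v ∈ z ∷ xs → v ∈ e ∷ c ∷ f ∷ g ∷ used₀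
        required-used i = there (there (there (there (there (there i)))))

  -- The two sides of the cut

  -- A linear inequality a ≤ b follows from another one, c ≤ d, with slack k; the side condition has
  -- no subtraction and is a semiring identity.
  linear : ∀ {a b c d} k → c ≤ d → a + d + k ≡ c + b → a ≤ b
  linear {a} {b} {c} {d} k c≤d eq = +-cancelʳ-≤ d a b (begin
    a + d     ≤⟨ m≤m+n (a + d) k ⟩
    a + d + k ≡⟨ eq ⟩
    c + b     ≤⟨ +-monoˡ-≤ b c≤d ⟩
    d + b     ≡⟨ +-comm d b ⟩
    b + d     ∎)
    where open ≤-Reasoning

  #-within : ∀ {n} (P Q : Fin n → Bool) → # P ≤ # (λ v → Q v ∧ P v) + # (λ v → P v ∧ not (Q v))
  #-within P Q = ≤-trans (≤-reflexive (#-split P Q)) (+-monoˡ-≤ _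
    (#-mono (λ v → P v ∧ Q v) (λ v → Q v ∧ P v) (λ v t → from T-∧ (proj₂ (to (T-∧ {P v}) t) , proj₁ (to (T-∧ {P v}) t)))))

  #-lookup : ∀ {n} (S : Subset n) → # (lookup S) ≡ ∣ S ∣
  #-lookup []          = refl
  #-lookup (true  ∷ S) = cong suc (#-lookup S)
  #-lookup (false ∷ S) = #-lookup S

  module _ {n : ℕ} (G : Graph n) (min-degree : MinDegAtLeastHalf G) where

    degree : ∀ v → n + 1 ≤ 2 * # (adj G v)
    degree v = subst (λ d → n + 1 ≤ 2 * d) (deg≡# G v) (min-degree v)

    -- Stated for an ordered pair of cores, to be applied once for each side; `s` is the size of the
    -- cut.
    module Cores (s : ℕ) (C D : Fin n → Bool)
      (disjoint : ∀ {x} → T (C x) → ¬ T (D x))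
      (no-edge : ∀ {x y} → T (C x) → T (D y) → ¬ Adj G x y)
      (big-C : n + 1 ≤ 2 * # C + 2 * s) (big-D : n + 1 ≤ 2 * # D + 2 * s)
      (n-large : 84 * s + 56 ≤ n) where

      Rest : Fin n → Bool
      Rest v = not (C v) ∧ not (D v)

      partition : # C + # D + # Rest ≤ n
      partition = begin
        # C + # D + # Rest       ≡⟨ +-assoc (# C) (# D) (# Rest) ⟩
        # C + (# D + # Rest)     ≤⟨ +-monoʳ-≤ (# C) (+-monoˡ-≤ (# Rest) (#-mono D (λ v → not (C v) ∧ D v)
                                      (λ v d → from T-∧ (T-not (λ c → disjoint c d) , d)))) ⟩
        # C + (# (λ v → not (C v) ∧ D v) + # Rest) ≡⟨ cong (# C +_) (≡-sym (#-split (λ v → not (C v)) D)) ⟩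
        # C + # (λ v → not (C v)) ≡⟨ ≡-sym (#-split (λ _ → true) C) ⟩
        # {n} (λ _ → true)        ≡⟨ #-full n ⟩
        n                         ∎
        where open ≤-Reasoning

      -- The two disjoint cores together have at least n + 1 - 2s vertices.
      rest≤ : # Rest ≤ 2 * s
      rest≤ = *-cancelˡ-≤ 2 (linear 2
        (+-mono-≤ (+-mono-≤ big-C big-D) (*-monoʳ-≤ 2 partition))
        (eq n s (# C) (# D) (# Rest)))
        where
        eq : ∀ n s c d r → 2 * r + (2 * c + 2 * s + (2 * d + 2 * s) + 2 * n) + 2 ≡
          (n + 1 + (n + 1) + 2 * (c + d + r)) + 2 * (2 * s)
        eq = solve-∀

      inC inD : Fin n → ℕ
      inC v = # (λ u → C u ∧ adj G v u)
      inD v = # (λ u → D u ∧ adj G v u)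

      neighbours≤ : ∀ v → # (adj G v) ≤ inC v + (inD v + # Rest)
      neighbours≤ v = ≤-trans (#-within (adj G v) C) (+-monoʳ-≤ _ (≤-trans (#-within (λ u → adj G v u ∧ not (C u)) D)
        (+-mono-≤
          (#-mono _ (λ u → D u ∧ adj G v u) (λ u t → from T-∧ (proj₁ (to (T-∧ {D u}) t) ,
            proj₁ (to (T-∧ {adj G v u}) (proj₂ (to (T-∧ {D u}) t))))))
          (#-mono _ Rest (λ u t → from T-∧ (proj₂ (to (T-∧ {adj G v u}) (proj₁ (to (T-∧ {adj G v u ∧ not (C u)}) t))) ,
            proj₂ (to (T-∧ {adj G v u ∧ not (C u)}) t)))))))

      none-across : ∀ {v} → T (C v) → inD v ≡ 0
      none-across cv = #-empty _ (λ u t → no-edge cv (proj₁ (to (T-∧ {D u}) t)) (proj₂ (to (T-∧ {D u}) t)))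

      -- All neighbours of a core vertex lie in `C` or among the few vertices of `Rest`. The strict
      -- preference for its own core settles the tie in `coreY∩`.
      some-inside : ∀ {v} → T (C v) → 1 ≤ inC v
      some-inside {v} cv = *-cancelˡ-≤ 2 (linear (80 * s + 55)
        (+-mono-≤ (+-mono-≤ n-large (degree v)) (+-mono-≤ (*-monoʳ-≤ 2 (neighbours≤ v))
          (+-mono-≤ (≤-reflexive (cong (2 *_) (none-across cv))) (*-monoʳ-≤ 2 rest≤))))
        (eq n s (# Rest) (# (adj G v)) (inC v) (inD v)))
        where
        eq : ∀ n s r g y e → 2 * 1 + (n + 2 * g + (2 * (y + (e + r)) + (2 * 0 + 2 * (2 * s)))) + (80 * s + 55) ≡
          (84 * s + 56 + (n + 1) + (2 * g + (2 * e + 2 * r))) + 2 * y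
        eq = solve-∀

      core-large : 4 ≤ # C
      core-large = *-cancelˡ-≤ 2 (linear (82 * s + 49) (+-mono-≤ n-large big-C) (eq n s (# C)))
        where
        eq : ∀ n s c → 2 * 4 + (n + (2 * c + 2 * s)) + (82 * s + 49) ≡ (84 * s + 56 + (n + 1)) + 2 * c
        eq = solve-∀

      -- `v` has at least (n+1)/2 neighbours, all in `C` or `Rest`, while these two sets have at
      -- most (n-1)/2 + s vertices together. Fewer than s are missed; the weaker bound `2 * s` is
      -- shared with `few`.
      dense : ∀ {v} → T (C v) → # (λ u → C u ∧ not (adj G v u)) ≤ 2 * s
      dense {v} cv = *-cancelˡ-≤ 2 (linear (2 + 2 * s)
        (+-mono-≤ (+-mono-≤ big-D (degree v))
          (+-mono-≤ (+-mono-≤ (*-monoʳ-≤ 2 (neighbours≤ v)) (≤-reflexive (cong (2 *_) (none-across cv))))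
            (+-mono-≤ (*-monoʳ-≤ 2 partition) (≤-reflexive (cong (2 *_) (≡-sym (#-split C (adj G v))))))))
        (eq n s (# C) (# D) (# Rest) (# (adj G v)) (inC v) (inD v) (# (λ u → C u ∧ not (adj G v u)))))
        where
        eq : ∀ n s c d r g y e k →
          2 * k + (2 * d + 2 * s + 2 * g + (2 * (y + (e + r)) + 2 * 0 + (2 * n + 2 * c))) + (2 + 2 * s) ≡
          (n + 1 + (n + 1) + (2 * g + 2 * e + (2 * (c + d + r) + 2 * (y + k)))) + 2 * (2 * s)
        eq = solve-∀

      module _ (A : Fin n → Bool) (C⊆A : ∀ {x} → T (C x) → T (A x)) (D⊆¬A : ∀ {x} → T (D x) → ¬ T (A x))
        (majority : ∀ {v} → T (A v) → inD v ≤ inC v) where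

        -- At least half of the neighbours outside `Rest` are in `C`, which is (n+1)/4 - s or more.
        -- With n at least 84s + 56 this gives `20 * s + 14`, exactly what `large` asks for.
        rich : ∀ {v} → T (A v) → 20 * s + 14 ≤ inC v
        rich {v} av = *-cancelˡ-≤ 4 (linear 1
          (+-mono-≤ (+-mono-≤ n-large (degree v)) (+-mono-≤ (*-monoʳ-≤ 2 (neighbours≤ v))
            (+-mono-≤ (*-monoʳ-≤ 2 (majority av)) (*-monoʳ-≤ 2 rest≤))))
          (eq n s (# Rest) (# (adj G v)) (inC v) (inD v)))
          where
          eq : ∀ n s r g y e → 4 * (20 * s + 14) + (n + 2 * g + (2 * (y + (e + r)) + (2 * y + 2 * (2 * s)))) + 1 ≡
            (84 * s + 56 + (n + 1) + (2 * g + (2 * e + 2 * r))) + 4 * y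
          eq = solve-∀

        few : # (λ v → A v ∧ not (C v)) ≤ 2 * s
        few = ≤-trans (#-mono _ Rest (λ v t → from T-∧ (proj₂ (to (T-∧ {A v}) t) ,
          T-not (λ d → D⊆¬A d (proj₁ (to (T-∧ {A v}) t)))))) rest≤

        large : 10 * (2 * s) + 13 < 20 * s + 14
        large = ≤-reflexive (eq s)
          where
          eq : ∀ s → suc (10 * (2 * s) + 13) ≡ 20 * s + 14
          eq = solve-∀

        open Side G A C (2 * s) (20 * s + 14) C⊆A dense rich few large public using (sideForest)

    -- Three disjoint edges between the sides

    record CrossEdges (A B : Fin n → Bool) : Set where
      constructor cross
      field
        {a₁ a₂ a₃ b₁ b₂ b₃} : Fin n
        in-A     : T (A a₁) × T (A a₂) × T (A a₃)
        in-B     : T (B b₁) × T (B b₂) × T (B b₃)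
        a-≢      : a₁ ≢ a₂ × a₁ ≢ a₃ × a₂ ≢ a₃
        b-≢      : b₁ ≢ b₂ × b₁ ≢ b₃ × b₂ ≢ b₃
        adjacent : Adj G a₁ b₁ × Adj G a₂ b₂ × Adj G a₃ b₃

    module Crossing (A B : Fin n → Bool) (B⇒¬A : ∀ {v} → T (B v) → ¬ T (A v)) (¬A⇒B : ∀ {v} → ¬ T (A v) → T (B v))
      (A-small : 2 * # A ≤ n) (A-large : 4 ≤ # A) (B-large : 3 ≤ # B) where

      loop-free : ∀ {v u} → Adj G v u → u ≢ v
      loop-free {v} a refl = subst T (irrefl G v) a

      own≤ : ∀ (P : Fin n → Bool) {v} → T (P v) → suc (# (λ u → P u ∧ adj G v u)) ≤ # P
      own≤ P {v} pv = ≤-trans (s≤s (#-mono _ (P ∖ v) (λ u t →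
        ∈-∖⁺ {P = P} (proj₁ (to (T-∧ {P u}) t)) (loop-free (proj₂ (to (T-∧ {P u}) t)))))) (#-remove-≥ P v pv)

      degree≤ : ∀ v → # (adj G v) ≤ # (λ u → A u ∧ adj G v u) + # (λ u → B u ∧ adj G v u)
      degree≤ v = ≤-trans (#-within (adj G v) A) (+-monoʳ-≤ _ (#-mono _ (λ u → B u ∧ adj G v u)
        (λ u t → from T-∧ (¬A⇒B (T-not⁻ (proj₂ (to (T-∧ {adj G v u}) t))) , proj₁ (to (T-∧ {adj G v u}) t)))))

      sizes : # A + # B ≤ n
      sizes = begin
        # A + # B                ≤⟨ +-monoʳ-≤ (# A) (#-mono B (λ v → not (A v)) (λ v b → T-not (B⇒¬A b))) ⟩
        # A + # (λ v → not (A v)) ≡⟨ ≡-sym (#-split (λ _ → true) A) ⟩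
        # {n} (λ _ → true)        ≡⟨ #-full n ⟩
        n                         ∎
        where open ≤-Reasoning

      acrossOf : Fin n → Fin n → Bool
      acrossOf v u = B u ∧ adj G v u

      -- At most n/2 - 1 neighbours lie in `A`, so at least 3/2 lie across, hence two.
      two-across : ∀ {a} → T (A a) → 2 ≤ # (acrossOf a)
      two-across {a} ta = *-cancelˡ-< 2 1 _ (linear 0
        (+-mono-≤ (+-mono-≤ A-small (degree a)) (+-mono-≤ (*-monoʳ-≤ 2 (degree≤ a)) (*-monoʳ-≤ 2 (own≤ A ta))))
        (eq n (# A) (# (adj G a)) (# (λ u → A u ∧ adj G a u)) (# (acrossOf a))))
        where
        eq : ∀ n α g p q → 3 + (n + 2 * g + (2 * (p + q) + 2 * α)) + 0 ≡
          (2 * α + (n + 1) + (2 * g + 2 * suc p)) + 2 * q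
        eq = solve-∀

      neighbour-avoiding : ∀ {a} b → T (A a) → ∃ λ b′ → T (B b′) × Adj G a b′ × b′ ≢ b
      neighbour-avoiding {a} b ta = pick (acrossOf a) (b ∷ []) (two-across ta) |>′ λ (b′ , t , b′∉) →
        b′ , proj₁ (to (T-∧ {B b′}) t) , proj₂ (to (T-∧ {B b′}) t) , λ e → b′∉ (here e)

      Escapes : Fin n → Fin n → Fin n → Set
      Escapes b₁ b₂ a = ∃ λ b → T (B b) × Adj G a b × b ≢ b₁ × b ≢ b₂

      escapes? : ∀ b₁ b₂ a → Dec (Escapes b₁ b₂ a)
      escapes? b₁ b₂ a = any? (λ b → T? (B b) ×-dec T? (adj G a b) ×-dec ¬? (b ≟ b₁) ×-dec ¬? (b ≟ b₂))

      confined : ∀ {b₁ b₂ a} → ¬ Escapes b₁ b₂ a → ∀ {b} → T (B b) → Adj G a b → b ≡ b₁ ⊎ b ≡ b₂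
      confined {b₁} {b₂} none {b} tb ab with b ≟ b₁ | b ≟ b₂
      ... | yes e | _     = inj₁ e
      ... | no _  | yes e = inj₂ e
      ... | no n₁ | no n₂ = contradiction (b , tb , ab , n₁ , n₂) none

      -- If b₁ and b₂ met all the cross edges, the degrees of a vertex of A and of a further vertex of B
      -- would be at most # A + 1 and # B - 1, and would add up to at most n.
      some-escape : ∀ b₁ b₂ → ∃ λ a → T (A a) × Escapes b₁ b₂ a
      some-escape b₁ b₂ with any? (λ a → T? (A a) ×-dec escapes? b₁ b₂ a)
      ... | yes found = found
      ... | no none with pick A [] (≤-trans (s≤s z≤n) A-large) | pick B (b₁ ∷ b₂ ∷ []) B-large
      ...   | a , ta , _ | b , tb , b∉ = contradiction
        (linear {2} {0} 0
          (+-mono-≤ (*-monoʳ-≤ 2 sizes) (+-mono-≤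
            (+-mono-≤ (+-mono-≤ (degree a) (*-monoʳ-≤ 2 (degree≤ a))) (+-mono-≤ (*-monoʳ-≤ 2 (own≤ A ta)) (*-monoʳ-≤ 2 at-most-two)))
            (+-mono-≤ (+-mono-≤ (degree b) (*-monoʳ-≤ 2 (degree≤ b))) (+-mono-≤ (*-monoʳ-≤ 2 (own≤ B tb)) (*-monoʳ-≤ 2 isolated)))))
          (eq n (# A) (# B) (# (adj G a)) (# (λ u → A u ∧ adj G a u)) (# (acrossOf a))
            (# (adj G b)) (# (λ u → B u ∧ adj G b u)) (# (λ u → A u ∧ adj G b u)))) λ ()
        where
        at-most-two : # (acrossOf a) ≤ 2
        at-most-two = #≤length (acrossOf a) (b₁ ∷ b₂ ∷ []) λ v t →
          [ here , there ∘ here ]′ (confined (λ e → none (a , ta , e)) (proj₁ (to (T-∧ {B v}) t)) (proj₂ (to (T-∧ {B v}) t)))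
        isolated : # (λ u → A u ∧ adj G b u) ≤ 0
        isolated = ≤-reflexive (#-empty _ λ u t → b∉ ([ here , there ∘ here ]′
          (confined (λ e → none (u , proj₁ (to (T-∧ {A u}) t) , e)) tb (adj-sym {G = G} (proj₂ (to (T-∧ {A u}) t))))))
        eq : ∀ n α β g p q g′ p′ e →
          2 + (2 * n + (2 * g + 2 * (p + q) + (2 * α + 2 * 2) + (2 * g′ + 2 * (e + p′) + (2 * β + 2 * 0)))) + 0 ≡
          (2 * (α + β) + (n + 1 + 2 * g + (2 * suc p + 2 * q) + (n + 1 + 2 * g′ + (2 * suc p′ + 2 * e)))) + 0
        eq = solve-∀

      -- By `two-across` there are two neighbours in `B`; if neither `b₁` nor `b₂` can be avoided,
      -- they are these two.
      forced : ∀ {b₁ b₂ a} → T (A a) → ¬ Escapes b₁ b₂ a → Adj G a b₁ × Adj G a b₂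
      forced {b₁} {b₂} {a} ta none = meets (neighbour-avoiding b₂ ta) swap ,
                                     meets (neighbour-avoiding b₁ ta) (λ e → e)
        where
        meets : ∀ {b c} → (∃ λ b′ → T (B b′) × Adj G a b′ × b′ ≢ b) →
          (∀ {x} → x ≡ b₁ ⊎ x ≡ b₂ → x ≡ b ⊎ x ≡ c) → Adj G a c
        meets (b′ , tb′ , ab′ , b′≢b) order with order (confined none tb′ ab′)
        ... | inj₁ e    = contradiction e b′≢b
        ... | inj₂ refl = ab′

      module _ {a₁ a₂ b₁ b₂} (t₁ : T (A a₁)) (t₂ : T (A a₂)) (u₁ : T (B b₁)) (u₂ : T (B b₂))
        (a₂≢a₁ : a₂ ≢ a₁) (b₂≢b₁ : b₂ ≢ b₁) (e₁ : Adj G a₁ b₁) (e₂ : Adj G a₂ b₂) where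

        third : ∀ {a} → T (A a) → a ∉ a₁ ∷ a₂ ∷ [] → Escapes b₁ b₂ a → CrossEdges A B
        third ta a∉ (b , tb , ab , b≢₁ , b≢₂) = cross (t₁ , t₂ , ta) (u₁ , u₂ , tb)
          (≢-sym a₂≢a₁ , (λ e → a∉ (here (≡-sym e))) , λ e → a∉ (there (here (≡-sym e))))
          (≢-sym b₂≢b₁ , ≢-sym b≢₁ , ≢-sym b≢₂) (e₁ , e₂ , ab)

        -- Two vertices of A outside a₁, a₂ either escape or can take over the edges at b₁ and b₂.
        reroute : ∀ {a} → T (A a) → Escapes b₁ b₂ a → a ∈ a₁ ∷ a₂ ∷ [] → CrossEdges A B
        reroute {a} ta (b , tb , ab , b≢₁ , b≢₂) a∈ =
          pick A (a₁ ∷ a₂ ∷ []) (≤-trans (n≤1+n 3) A-large) |>′ λ (a₃ , t₃ , a₃∉) →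
          pick A (a₃ ∷ a₁ ∷ a₂ ∷ []) A-large |>′ λ (a₄ , t₄ , a₄∉) →
          decide t₃ t₄ a₃∉ a₄∉ (escapes? b₁ b₂ a₃) (escapes? b₁ b₂ a₄)
          where
          decide : ∀ {a₃ a₄} → T (A a₃) → T (A a₄) → a₃ ∉ a₁ ∷ a₂ ∷ [] → a₄ ∉ a₃ ∷ a₁ ∷ a₂ ∷ [] →
            Dec (Escapes b₁ b₂ a₃) → Dec (Escapes b₁ b₂ a₄) → CrossEdges A B
          decide t₃ t₄ a₃∉ a₄∉ (yes x) _       = third t₃ a₃∉ x
          decide t₃ t₄ a₃∉ a₄∉ (no _)  (yes x) = third t₄ (a₄∉ ∘ there) x
          decide t₃ t₄ a₃∉ a₄∉ (no x)  (no y)  = cross (t₃ , t₄ , ta) (u₁ , u₂ , tb)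
            ((λ e → a₄∉ (here (≡-sym e))) , (λ { refl → a₃∉ a∈ }) , (λ { refl → a₄∉ (there a∈) }))
            (≢-sym b₂≢b₁ , ≢-sym b≢₁ , ≢-sym b≢₂) (proj₁ (forced t₃ x) , proj₂ (forced t₄ y) , ab)

        extend-two : CrossEdges A B
        extend-two = some-escape b₁ b₂ |>′ λ (a , ta , esc) → decide ta esc (a ≟ a₁) (a ≟ a₂)
          where
          decide : ∀ {a} → T (A a) → Escapes b₁ b₂ a → Dec (a ≡ a₁) → Dec (a ≡ a₂) → CrossEdges A B
          decide ta esc (yes e) _       = reroute ta esc (here e)
          decide ta esc (no _)  (yes e) = reroute ta esc (there (here e))
          decide ta esc (no n₁) (no n₂) = third ta (λ { (here e) → n₁ e ; (there (here e)) → n₂ e }) esc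

      crossEdges : CrossEdges A B
      crossEdges =
        pick A [] (≤-trans (s≤s z≤n) A-large) |>′ λ (a₁ , t₁ , _) →
        pick A (a₁ ∷ []) (≤-trans (s≤s (s≤s z≤n)) A-large) |>′ λ (a₂ , t₂ , a₂∉) →
        neighbour-avoiding a₁ t₁ |>′ λ (b₁ , u₁ , e₁ , _) →
        neighbour-avoiding b₁ t₂ |>′ λ (b₂ , u₂ , e₂ , b₂≢b₁) →
        extend-two t₁ t₂ u₁ u₂ (λ e → a₂∉ (here e)) b₂≢b₁ e₁ e₂

    -- The root is `a₁` with `b₁` as first child. The leaves run from `b₃` to `b₂` on one side and
    -- from `a₂` to `a₃` on the other, and `e₂`, `e₃` close the cycle; hence the reversed order of
    -- ends in `FB`.
    join : ∀ {A B : Fin n → Bool} → (∀ {v} → T (B v) → ¬ T (A v)) → (∀ {v} → ¬ T (A v) → T (B v)) → 4 ≤ n →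
      (∀ {r a z} → T (A r) → T (A a) → T (A z) → r ≢ a → r ≢ z → a ≢ z → SideForest G A r a z) →
      (∀ {r a z} → T (B r) → T (B a) → T (B z) → r ≢ a → r ≢ z → a ≢ z → SideForest G B r a z) →
      CrossEdges A B → HasSpanningHalinSubgraph G
    join {A} {B} B⇒¬A ¬A⇒B 4≤n sideA sideB
      (cross {a₁} {a₂} {a₃} {b₁} {b₂} {b₃} (ta₁ , ta₂ , ta₃) (tb₁ , tb₂ , tb₃)
        (a₁₂ , a₁₃ , a₂₃) (b₁₂ , b₁₃ , b₂₃) (e₁ , e₂ , e₃)) =
      PlaneTree.halin a₁ (cons b₁ FB.forest FA.forest)
        (unique-resp-↭ (shift a₁ (b₁ ∷ labels FB.forest) (labels FA.forest))
          (++⁺ FB.distinct FA.distinct (λ (i , j) → B⇒¬A (All.lookup all-B i) (All.lookup all-A j))))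
        covers (≤-reflexive (cong suc (≡-sym FA.two-roots)))
        ((λ one → contradiction (trans (≡-sym FB.two-roots) one) λ ()) , FB.branching , FA.branching)
        4≤n (e₁ , FB.edges , FA.edges)
        (trans (leaves-cons b₁ FB.forest FA.forest FB.leaves≡) (cong ((b₃ ∷ FB.others) ++_) FA.leaves≡))
        (subst (λ l → Walk (Adj G) b₃ l b₃) (≡-sym (++-assoc FB.others (a₂ ∷ FA.others) (b₃ ∷ [])))
          (FB.leaf-walk ++ʷ (adj-sym {G = G} e₂ ∷ (FA.leaf-walk ++ʷ (e₃ ∷ [])))))
      where
      FA : SideForest G A a₁ a₂ a₃
      FA = sideA ta₁ ta₂ ta₃ a₁₂ a₁₃ a₂₃
      FB : SideForest G B b₁ b₃ b₂
      FB = sideB tb₁ tb₃ tb₂ b₁₃ b₁₂ (≢-sym b₂₃)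
      module FA = SideForest FA
      module FB = SideForest FB
      all-A : All (T ∘ A) (a₁ ∷ labels FA.forest)
      all-A = ta₁ ∷ FA.inside
      all-B : All (T ∘ B) (b₁ ∷ labels FB.forest)
      all-B = tb₁ ∷ FB.inside
      leaves-cons : ∀ v cs ss {x xs} → leaves {n} cs ≡ x ∷ xs → leaves (cons v cs ss) ≡ x ∷ xs ++ leaves ss
      leaves-cons v (cons _ _ _) ss e = cong (_++ leaves ss) e
      covers : ∀ v → v ∈ a₁ ∷ b₁ ∷ labels FB.forest ++ labels FA.forest
      covers v with T? (A v)
      ... | no ¬a = there (∈-++⁺ˡ (FB.spanning (¬A⇒B ¬a)))
      ... | yes a with FA.spanning a
      ...   | here e  = here e
      ...   | there i = there (∈-++⁺ʳ (b₁ ∷ labels FB.forest) i)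

    -- From the vertex cut to the two sides

    module _ {x y : Fin n} (S : Subset n) (x∉S : x Subset.∉ S) (y∉S : y Subset.∉ S)
      (cut : ¬ ReachIn G (λ v → v Subset.∉ S) x y) (n-large : 84 * ∣ S ∣ + 56 ≤ n) where

      core : Fin n → Fin n → Bool
      core z v = adj G z v ∧ not (lookup S v)

      core-∉ : ∀ z {v} → T (core z v) → v Subset.∉ S
      core-∉ z {v} c v∈S = subst (T ∘ not) ([]=⇒lookup v∈S) (proj₂ (to (T-∧ {adj G z v}) c))

      core-adj : ∀ z {v} → T (core z v) → Adj G z v
      core-adj z {v} c = proj₁ (to (T-∧ {adj G z v}) c)

      core-big : ∀ z → n + 1 ≤ 2 * # (core z) + 2 * ∣ S ∣
      core-big z = begin
        n + 1                          ≤⟨ degree z ⟩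
        2 * # (adj G z)                ≡⟨ cong (2 *_) (#-split (adj G z) (lookup S)) ⟩
        2 * (# (λ v → adj G z v ∧ lookup S v) + # (core z))
          ≤⟨ *-monoʳ-≤ 2 (+-monoˡ-≤ (# (core z)) (#-mono _ (lookup S) (λ v t → proj₂ (to (T-∧ {adj G z v}) t)))) ⟩
        2 * (# (lookup S) + # (core z)) ≡⟨ cong (λ k → 2 * (k + # (core z))) (#-lookup S) ⟩
        2 * (∣ S ∣ + # (core z))       ≡⟨ eq ∣ S ∣ (# (core z)) ⟩
        2 * # (core z) + 2 * ∣ S ∣     ∎
        where
        open ≤-Reasoning
        eq : ∀ s c → 2 * (s + c) ≡ 2 * c + 2 * s
        eq = solve-∀

      -- A common vertex would join `x` to `y` outside `S` in two steps; an edge between the cores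
      -- would do so in three.
      core-disjoint : ∀ {v} → T (core x v) → ¬ T (core y v)
      core-disjoint c d = cut (step x∉S (core-adj x c) (step (core-∉ x c) (adj-sym {G = G} (core-adj y d)) (here y∉S)))

      core-no-edge : ∀ {v w} → T (core x v) → T (core y w) → ¬ Adj G v w
      core-no-edge c d a = cut (step x∉S (core-adj x c) (step (core-∉ x c) a
        (step (core-∉ y d) (adj-sym {G = G} (core-adj y d)) (here y∉S))))

      module X = Cores ∣ S ∣ (core x) (core y) core-disjoint core-no-edge (core-big x) (core-big y) n-large
      module Y = Cores ∣ S ∣ (core y) (core x) (λ d c → core-disjoint c d)
        (λ d c a → core-no-edge c d (adj-sym {G = G} a)) (core-big y) (core-big x) n-large

      -- Each vertex goes to the side in whose core it has more neighbours, with ties going to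
      -- `sideX`.
      sideX sideY : Fin n → Bool
      sideX v = ⌊ X.inD v ≤? X.inC v ⌋
      sideY v = not (sideX v)

      coreX⊆ : ∀ {v} → T (core x v) → T (sideX v)
      coreX⊆ {v} c = fromWitness (≤-trans (≤-reflexive (X.none-across c)) z≤n)

      coreY∩ : ∀ {v} → T (core y v) → ¬ T (sideX v)
      coreY∩ d t = contradiction (≤-trans (Y.some-inside d) (≤-trans (toWitness t) (≤-reflexive (Y.none-across d)))) λ ()

      forestX : ∀ {r a z} → T (sideX r) → T (sideX a) → T (sideX z) → r ≢ a → r ≢ z → a ≢ z → SideForest G sideX r a z
      forestX = X.sideForest sideX coreX⊆ coreY∩ toWitness

      forestY : ∀ {r a z} → T (sideY r) → T (sideY a) → T (sideY z) → r ≢ a → r ≢ z → a ≢ z → SideForest G sideY r a z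
      forestY = Y.sideForest sideY (λ d → T-not (coreY∩ d)) (λ c t → T-not⁻ t (coreX⊆ c))
        (λ t → <⇒≤ (≰⇒> (λ le → T-not⁻ t (fromWitness le))))

      sides-size : # sideX + # sideY ≡ n
      sides-size = trans (≡-sym (#-split (λ _ → true) sideX)) (#-full n)

      sideX-large : 4 ≤ # sideX
      sideX-large = ≤-trans X.core-large (#-mono (core x) sideX (λ v → coreX⊆))

      sideY-large : 4 ≤ # sideY
      sideY-large = ≤-trans Y.core-large (#-mono (core y) sideY (λ v d → T-not (coreY∩ d)))

      4≤n : 4 ≤ n
      4≤n = ≤-trans (m≤m+n 4 52) (≤-trans (m≤n+m 56 (84 * ∣ S ∣)) n-large)

      small-half : ∀ {a b} → a ≤ b → a + b ≡ n → 2 * a ≤ n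
      small-half {a} {b} a≤b e = ≤-trans (≤-reflexive (cong (a +_) (+-identityʳ a)))
        (≤-trans (+-monoʳ-≤ a a≤b) (≤-reflexive e))

      spanningHalin : HasSpanningHalinSubgraph G
      -- `Crossing` wants the side with at most n/2 vertices first.
      spanningHalin with ≤-total (# sideX) (# sideY)
      ... | inj₁ X≤Y = join T-not⁻ T-not 4≤n forestX forestY
        (Crossing.crossEdges sideX sideY T-not⁻ T-not (small-half X≤Y sides-size) sideX-large (≤-trans (n≤1+n 3) sideY-large))
      ... | inj₂ Y≤X = join (λ a b → T-not⁻ b a) ¬Y⇒X 4≤n forestY forestX
        (Crossing.crossEdges sideY sideX (λ a b → T-not⁻ b a) ¬Y⇒X
          (small-half Y≤X (trans (+-comm (# sideY) (# sideX)) sides-size)) sideY-large (≤-trans (n≤1+n 3) sideX-large))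
        where
        ¬Y⇒X : ∀ {v} → ¬ T (sideY v) → T (sideX v)
        ¬Y⇒X {v} h with sideX v
        ... | true  = tt
        ... | false = h tt

  -- Numerical bounds

  cut-size-bound : ∀ s n (β : ℚ.ℚ) → β ℚ.≤ ℤ.+ 1 ℚ./ 98260 →
    ℤ.+ s ℚ./ 1 ℚ.≤ (ℤ.+ 5 ℚ./ 1) ℚ.* β ℚ.* (ℤ.+ n ℚ./ 1) → 19652 * s ≤ n
  cut-size-bound s n β β≤ s≤ = ≤-trans (≤-reflexive (*-comm 19652 s)) (ℤ.drop‿+≤+
    (subst₂ ℤ._≤_ (≡-sym (ℤ.pos-* s 19652))
      (trans (ℤ.*-identityʳ (ℤ.+ 1 ℤ.* ℤ.+ n)) (ℤ.*-identityˡ (ℤ.+ n))) (ℚᵘ.drop-*≤* step₂)))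
    where
    -- 98260 = 5 · 19652, so five times the bound on `β` is 1/19652.
    step₁ : ℤ.+ s ℚ./ 1 ℚ.≤ (ℤ.+ 1 ℚ./ 19652) ℚ.* (ℤ.+ n ℚ./ 1)
    step₁ = ℚ.≤-trans s≤ (ℚ.*-monoʳ-≤-nonNeg (ℤ.+ n ℚ./ 1) {{ℚ.normalize-nonNeg n 1}}
      (ℚ.*-monoˡ-≤-nonNeg (ℤ.+ 5 ℚ./ 1) β≤))
    -- Unnormalised fractions avoid the division by the gcd in `ℚ./`, so that the order unfolds to a
    -- cross-multiplication of integers.
    step₂ : ℚᵘ.mkℚᵘ (ℤ.+ s) 0 ℚᵘ.≤ ℚᵘ.mkℚᵘ (ℤ.+ 1) 19651 ℚᵘ.* ℚᵘ.mkℚᵘ (ℤ.+ n) 0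
    step₂ = ℚᵘ.≤-respˡ-≃ (ℚ.toℚᵘ-fromℚᵘ (ℚᵘ.mkℚᵘ (ℤ.+ s) 0)) (ℚᵘ.≤-respʳ-≃
      (ℚᵘ.≃-trans (ℚ.toℚᵘ-homo-* (ℤ.+ 1 ℚ./ 19652) (ℤ.+ n ℚ./ 1))
        (ℚᵘ.*-congˡ {ℚᵘ.mkℚᵘ (ℤ.+ 1) 19651} (ℚ.toℚᵘ-fromℚᵘ (ℚᵘ.mkℚᵘ (ℤ.+ n) 0))))
      (ℚ.toℚᵘ-mono-≤ step₁))

  -- Half of `n` covers 56 and the other half covers `84 * s`; hence 112 and 168.
  n-large-enough : ∀ {s n} → 112 ≤ n → 19652 * s ≤ n → 84 * s + 56 ≤ n
  n-large-enough {s} {n} 112≤n ratio = *-cancelˡ-≤ 2 (linear 0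
    (+-mono-≤ 112≤n (≤-trans (*-monoˡ-≤ s (m≤m+n 168 19484)) ratio)) (eq s n))
    where
    eq : ∀ s n → 2 * (84 * s + 56) + (n + n) + 0 ≡ 112 + 168 * s + 2 * n
    eq = solve-∀

open import Data.Nat using (ℕ; _≥_)
open import Data.Integer using (+_)
open import Data.Rational using (ℚ; _/_; _<_; _≤_; _*_; 0ℚ)
open import Data.Rational.Properties using (≤-refl; positive⁻¹; ≤-trans)
open import Data.Fin.Subset using (Subset; ∣_∣)
open import Data.Product using (Σ; _×_; _,_)

theorem3p1 : Σ ℚ λ β₀ → 0ℚ < β₀ × β₀ ≤ + 1 / 98260 ×
    ((β : ℚ) → 0ℚ < β → β ≤ β₀ →
    Σ ℕ λ N → (n : ℕ) → n ≥ N → (G : Graph n) →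
    MinDegAtLeastHalf G →
    (S : Subset n) → IsVertexCut G S →
    + ∣ S ∣ / 1 ≤ (+ 5 / 1) * β * (+ n / 1) →
    HasSpanningHalinSubgraph G)
-- 98260 is 20 · 17³, and 112 is the bound required by `n-large-enough`.
theorem3p1 = + 1 / 98260 , positive⁻¹ (+ 1 / 98260) , ≤-refl , λ β _ β≤ → 112 ,
  λ n n≥ G min-degree S (x , y , x∉S , y∉S , cut) small →
    Lemmas.spanningHalin G min-degree S x∉S y∉S cut
      (Lemmas.n-large-enough {∣ S ∣} n≥ (Lemmas.cut-size-bound ∣ S ∣ n β β≤ small))
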